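{- Let $\{a_n\}_{n\ge1}$ be a sequence of positive real numbers such that the logarithmic differences $$\Delta\log a_n=\log a_{n+1}-\log a_n$$ satisfy $$\Delta\log a_n\to\infty\quad(n\to\infty)$$ and $$\Delta\log a_{n+1}=\Delta\log a_n+O\left(\frac1n\right)\quad(n\to\infty).$$ Then: (i) $\{a_n\}$ is not locally Benford distributed of order $k$ for any integer $k\ge2$. (ii) $\{a_n\}$ does not have Benford distributed waiting times.
   Context: For a positive real number $x$, the leading digit $D(x)\in\{1,2,\dots,9\}$ of $x$ in base $10$ is defined by: $D(x)=d$ if and only if $d\cdot 10^k\le x<(d+1)\cdot 10^k$ for some $k\in\mathbb{Z}$. For $d\in\{1,\dots,9\}$ let $P(d)=\log_{10}(1+1/d)$. Local Benford distribution: for a positive integer $k$, a sequence $\{a_n\}_{n\ge1}$ of positive real numbers is called locally Benford distributed of order $k$ if $$\lim_{N\to\infty}\frac1N\#\{n\le N: D(a_{n+i})=d_i\ (i=0,1,\dots,k-1)\}=P(d_0)P(d_1)\cdots P(d_{k-1})$$ for all choices of $d_0,\dots,d_{k-1}\in\{1,\dots,9\}$. Benford distributed waiting times: given a sequence $\{a_n\}_{n\ge1}$ of positive real numbers and $d\in\{1,\dots,9\}$, let $n_1^{(d)}<n_2^{(d)}<n_3^{(d)}<\cdots$ be the elements of $\{n\in\mathbb{N}: D(a_n)=d\}$ listed in increasing order, and let $w_i(d)=n_{i+1}^{(d)}-n_i^{(d)}$. The sequence $\{a_n\}$ is said to have Benford distributed waiting times if $$\lim_{N\to\infty}\frac1N\#\{i\le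 N: w_i(d)=k\}=P(d)(1-P(d))^{k-1}$$ for all $d\in\{1,\dots,9\}$ and all $k=1,2,\dots$ (so that, in particular, each set $\{n\in\mathbb{N}: D(a_n)=d\}$ has to be infinite). $\log$ denotes the natural logarithm. -}

module Defs where

open import Algebra.Bundles using (CommutativeRing; Semiring)
import Algebra.Definitions.RawSemiring as RawSemiringDefs
open import Axiom.ExcludedMiddle using (ExcludedMiddle)
open import Data.Fin.Base using (Fin; toℕ)
open import Data.Integer.Base using (ℤ; +_; -[1+_])
open import Data.List.Base using (applyUpTo; filter; length)
open import Data.Nat.Base as ℕ using (ℕ; suc; _∸_)
open import Data.Product.Base using (_×_; _,_; ∃; ∃-syntax)
open import Function.Bundles using (_⇔_)
open import Level using (0ℓ)
open import Relation.Binary.Core using (Rel)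
open import Relation.Binary.Definitions using (tri<; tri≈; tri>)
open import Relation.Binary.PropositionalEquality.Core using (_≡_)
open import Relation.Binary.Structures using (IsStrictTotalOrder)
import Relation.Binary.Construct.StrictToNonStrict as StrictToNonStrict
open import Relation.Nullary.Decidable.Core using (yes; no)
open import Relation.Nullary.Negation.Core using (¬_)

-- The real numbers, given axiomatically: an ordered field with the least
-- upper bound property is unique up to unique isomorphism.  The value of
-- 0# ⁻¹ is left unspecified.
record CompleteOrderedField : Set₁ where
  field
    commutativeRing : CommutativeRing 0ℓ 0ℓ

  open CommutativeRing commutativeRing public

  infix  4 _<_
  infix  8 _⁻¹

  field
    _<_                : Rel Carrier 0ℓ
    isStrictTotalOrder : IsStrictTotalOrder _≈_ _<_
    0<1                : 0# < 1#
    +-monoˡ-<          : ∀ z {x y} → x < y → x + z < y + z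
    *-pos              : ∀ {x y} → 0# < x → 0# < y → 0# < x * y
    _⁻¹                : Carrier → Carrier
    ⁻¹-inverseʳ        : ∀ {x} → ¬ (x ≈ 0#) → x * x ⁻¹ ≈ 1#

  open StrictToNonStrict _≈_ _<_ public using (_≤_)

  UpperBound : (Carrier → Set) → Carrier → Set
  UpperBound S u = ∀ x → S x → x ≤ u

  field
    lub : (S : Carrier → Set) → ∃ S → ∃ (UpperBound S) →
          ∃[ s ] (UpperBound S s × (∀ u → UpperBound S u → s ≤ u))

-- Excluded middle is needed for the classical reading of functions such as
-- the counting function and the logarithm, whose values depend on
-- undecidable properties of real numbers.  Sequences are functions on ℕ of
-- which only the terms with index n ≥ 1 matter; the term at 0 is ignored.
module Benford (em : ExcludedMiddle 0ℓ) (R : CompleteOrderedField) where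

  open CompleteOrderedField R renaming (Carrier to ℝ) public
  open IsStrictTotalOrder isStrictTotalOrder using (compare)
  open RawSemiringDefs (Semiring.rawSemiring semiring) using (_^_; product) renaming (_×_ to _·_)

  infixl 7 _/_
  infixr 8 _^ℤ_
  infix  4 _⟶_ _⟶∞ _=O_ D[_]=_

  fromℕ : ℕ → ℝ
  fromℕ n = n · 1#

  _/_ : ℝ → ℝ → ℝ
  x / y = x * y ⁻¹

  _^ℤ_ : ℝ → ℤ → ℝ
  x ^ℤ (+ n)    = x ^ n
  x ^ℤ -[1+ n ] = (x ^ suc n) ⁻¹

  ∣_∣ : ℝ → ℝ
  ∣ x ∣ with compare x 0#
  ... | tri< _ _ _ = - x
  ... | tri≈ _ _ _ = x
  ... | tri> _ _ _ = x

  _⟶_ : (ℕ → ℝ) → ℝ → Set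
  s ⟶ l = ∀ ε → 0# < ε → ∃[ N ] (∀ n → N ℕ.≤ n → ∣ s n - l ∣ < ε)

  _⟶∞ : (ℕ → ℝ) → Set
  s ⟶∞ = ∀ B → ∃[ N ] (∀ n → N ℕ.≤ n → B < s n)

  _=O_ : (ℕ → ℝ) → (ℕ → ℝ) → Set
  f =O g = ∃[ C ] ∃[ N ] (∀ n → N ℕ.≤ n → ∣ f n ∣ ≤ C * ∣ g n ∣)

  -- The limit of a convergent sequence, and 0# for a divergent one.
  lim : (ℕ → ℝ) → ℝ
  lim s with em {∃[ l ] (s ⟶ l)}
  ... | yes (l , _) = l
  ... | no  _       = 0#

  -- exp y = lim (1 + y/n)ⁿ
  exp : ℝ → ℝ
  exp y = lim (λ n → (1# + y / fromℕ n) ^ n)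

  -- The natural logarithm of x > 0; the value is 0# if x is not positive.
  log : ℝ → ℝ
  log x with em {∃[ y ] (exp y ≈ x)}
  ... | yes (y , _) = y
  ... | no  _       = 0#

  log₁₀ : ℝ → ℝ
  log₁₀ x = log x / log (fromℕ 10)

  -- The element d of Fin 9 stands for the digit toℕ d + 1.
  Digit : Set
  Digit = Fin 9

  value : Digit → ℕ
  value d = suc (toℕ d)

  -- D[ x ]= d says that the leading digit of x is d.
  D[_]=_ : ℝ → Digit → Set
  D[ x ]= d = ∃[ k ] (fromℕ (value d) * fromℕ 10 ^ℤ k ≤ x ×
                      x < fromℕ (suc (value d)) * fromℕ 10 ^ℤ k)

  P : Digit → ℝ
  P d = log₁₀ (1# + 1# / fromℕ (value d))

  -- #{ 1 ≤ n ≤ N : A n }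
  count : (ℕ → Set) → ℕ → ℕ
  count A N = length (filter (λ n → em {A n}) (applyUpTo suc N))

  HasDensity : (ℕ → Set) → ℝ → Set
  HasDensity A δ = (λ N → fromℕ (count A N) / fromℕ N) ⟶ δ

  LocallyBenford : (ℕ → ℝ) → ℕ → Set
  LocallyBenford a k =
    (d : Fin k → Digit) →
    HasDensity (λ n → ∀ i → D[ a (n ℕ.+ toℕ i) ]= d i) (product (λ i → P (d i)))

  -- ν 1 < ν 2 < ν 3 < ⋯ are the elements of A, which is thus infinite.
  record Enumerates (ν : ℕ → ℕ) (A : ℕ → Set) : Set where
    field
      increasing : ∀ i → 1 ℕ.≤ i → ν i ℕ.< ν (suc i)
      range      : ∀ n → A n ⇔ (∃[ i ] (1 ℕ.≤ i × ν i ≡ n))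

  -- The exponent k - 1 is written by letting the waiting time be suc k.
  -- The truncated subtraction is exact because ν is increasing.
  BenfordWaitingTimes : (ℕ → ℝ) → Set
  BenfordWaitingTimes a =
    ∀ d → ∃[ ν ] (Enumerates ν (λ n → 1 ℕ.≤ n × D[ a n ]= d) ×
      (∀ k → HasDensity (λ i → ν (suc i) ∸ ν i ≡ suc k) (P d * (1# - P d) ^ k)))

  Δlog : (ℕ → ℝ) → ℕ → ℝ
  Δlog a n = log (a (suc n)) - log (a n)

module Submission where

-- Write Δ n = log a(n+1) - log a(n).  Since Δ tends to infinity by steps
-- O(1/n), for arbitrarily large n it lies close to any prescribed value
-- modulo log 10, and it stays there during a window [n, n + n/q] with q
-- fixed.  Prescribing values in [log 2, log 2.1], we get windows in which,
-- up to powers of 10, each term is between 2 and 2.1 times the preceding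
-- one.  In such a window two consecutive terms never both have leading digit
-- 1, but a term with leading digit 1 occurs among any seven consecutive
-- terms.  Hence the digit pattern 1, …, 1 and the waiting time 1 for the
-- digit 1 are absent from windows of length proportional to their starting
-- point, which is impossible for an event of positive density.

-- Why 2 and 2.1: a factor of at least 2 forbids the digit 1 twice in a row, and a factor of at most
-- 2 could never jump over the range [1, 2). The windows only provide a factor in some interval, so
-- a small overshoot has to be tolerated. With 2.1 as upper end, the only overshoot goes from just
-- below 10 into [20, 21); since 21 · 2.1³ < 200, three further steps end between 160 and 200, again
-- with digit 1. `Δ` can be steered close to a prescribed value because it has to pass every high
-- level `t`, and by then its steps are too short to overshoot `t` by much. Waiting times are
-- counted along the index of an occurrence, not along the position in the sequence. The visits to
-- digit 1 in every seven terms make the two scales comparable: a window of positions contains a run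
-- of indices whose length is still proportional to its first index. Since `exp` is only given as a
-- limit, its functional equation and surjectivity are derived from the weighted AM-GM inequality
-- and the least upper bound property.

import Algebra.Definitions.RawSemiring as RawSemiringDefs
import Algebra.Properties.Ring as RingProperties
import Algebra.Properties.Semiring.Exp as SemiringExp
import Algebra.Properties.Semiring.Mult as SemiringMult
import Algebra.Properties.Semiring.Mult.TCOptimised as SemiringMult′
import Algebra.Solver.Ring as RingSolver
import Data.Bool.Base as Bool
import Data.Integer.Properties as ℤ
import Data.List.Properties as List
import Data.Nat.DivMod as ℕ
import Data.Nat.Properties as ℕ
import Data.Sign.Base as Sign
import Relation.Binary.Reasoning.Setoid as SetoidReasoning
import Relation.Binary.Reasoning.StrictPartialOrder as StrictPartialOrderReasoning
open import Algebra.Bundles using (CommutativeRing; RawRing; Semiring)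
open import Algebra.Solver.Ring.AlmostCommutativeRing using (fromCommutativeRing; _-Raw-AlmostCommutative⟶_)
open import Axiom.ExcludedMiddle using (ExcludedMiddle)
open import Data.Fin.Base as Fin using (Fin)
open import Data.Integer.Base as ℤ using (ℤ; +_; -[1+_])
open import Data.List.Base using (applyUpTo; filter; length; _∷_; [])
open import Data.Maybe.Base using (just; nothing)
open import Data.Nat.Base as ℕ using (ℕ; zero; suc; z≤n; s≤s)
open import Data.Nat.Tactic.RingSolver using (solve-∀)
open import Data.Product.Base using (_×_; _,_; ∃-syntax; proj₁; proj₂)
open import Data.Sum.Base using (_⊎_; inj₁; inj₂; [_,_]′)
open import Function.Bundles using (Equivalence)
open import Level using (0ℓ)
open import Relation.Binary.Bundles using (StrictPartialOrder)
open import Relation.Binary.Definitions using (tri<; tri≈; tri>; WeaklyDecidable)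
open import Relation.Binary.PropositionalEquality.Core as ≡ using (_≡_)
open import Relation.Binary.Structures using (IsStrictTotalOrder)
open import Relation.Nullary.Decidable.Core using (Dec; yes; no)
open import Relation.Nullary.Negation.Core using (¬_; contradiction)
open import Defs

-- A ring solver with integer coefficients.

module IntegerCoefficients (R : CommutativeRing 0ℓ 0ℓ) where

  open CommutativeRing R
  open RingProperties ring using (-‿+-comm; -‿distribˡ-*; -‿distribʳ-*; -0#≈0#; -‿involutive)
  open SemiringMult′ semiring renaming (_×_ to _·_)
  open SetoidReasoning setoid

  -- Equality in the carrier is not decidable by computation, so cancellation in normal forms is
  -- delegated to integer coefficients. The optimised multiple sends 1 to `1#` definitionally,
  -- whereas `fromℕ 2` unfolds to `1# + (1# + 0#)`; solver expressions below spell such numerals out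
  -- in that form.
  ⟦_⟧ : ℤ → Carrier
  ⟦ + n ⟧      = n · 1#
  ⟦ -[1+ n ] ⟧ = - (suc n · 1#)

  ⟦-⟧ : ∀ i → ⟦ ℤ.- i ⟧ ≈ - ⟦ i ⟧
  ⟦-⟧ (+ zero)  = sym -0#≈0#
  ⟦-⟧ (+ suc n) = refl
  ⟦-⟧ -[1+ n ]  = sym (-‿involutive _)

  +-cancel-sub : ∀ z x y → (z + x) - (z + y) ≈ x - y
  +-cancel-sub z x y = begin
    (z + x) + - (z + y)   ≈⟨ +-cong (+-comm x z) (-‿+-comm z y) ⟨
    (x + z) + (- z + - y) ≈⟨ +-assoc x z _ ⟩
    x + (z + (- z + - y)) ≈⟨ +-congˡ (+-assoc z (- z) (- y)) ⟨
    x + ((z + - z) + - y) ≈⟨ +-congˡ (+-congʳ (-‿inverseʳ z)) ⟩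
    x + (0# + - y)        ≈⟨ +-congˡ (+-identityˡ (- y)) ⟩
    x - y                 ∎

  ⟦⊖⟧ : ∀ m n → ⟦ m ℤ.⊖ n ⟧ ≈ m · 1# - n · 1#
  ⟦⊖⟧ zero    zero    = sym (-‿inverseʳ 0#)
  ⟦⊖⟧ zero    (suc n) = sym (+-identityˡ _)
  ⟦⊖⟧ (suc m) zero    = sym (trans (+-congˡ -0#≈0#) (+-identityʳ _))
  ⟦⊖⟧ (suc m) (suc n) = begin
    ⟦ suc m ℤ.⊖ suc n ⟧                ≡⟨ ≡.cong ⟦_⟧ (ℤ.[1+m]⊖[1+n]≡m⊖n m n) ⟩
    ⟦ m ℤ.⊖ n ⟧                        ≈⟨ ⟦⊖⟧ m n ⟩
    m · 1# - n · 1#                    ≈⟨ +-cancel-sub 1# _ _ ⟨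
    (1# + m · 1#) - (1# + n · 1#)      ≈⟨ +-cong (1+× m 1#) (-‿cong (1+× n 1#)) ⟨
    suc m · 1# - suc n · 1#            ∎

  ⟦+⟧ : ∀ i j → ⟦ i ℤ.+ j ⟧ ≈ ⟦ i ⟧ + ⟦ j ⟧
  ⟦+⟧ (+ m)    (+ n)    = ×-homo-+ 1# m n
  ⟦+⟧ (+ m)    -[1+ n ] = ⟦⊖⟧ m (suc n)
  ⟦+⟧ -[1+ m ] (+ n)    = trans (⟦⊖⟧ n (suc m)) (+-comm _ _)
  ⟦+⟧ -[1+ m ] -[1+ n ] = begin
    - (suc (suc (m ℕ.+ n)) · 1#)       ≡⟨ ≡.cong (λ k → - (suc k · 1#)) (ℕ.+-suc m n) ⟨
    - ((suc m ℕ.+ suc n) · 1#)         ≈⟨ -‿cong (×-homo-+ 1# (suc m) (suc n)) ⟩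
    - (suc m · 1# + suc n · 1#)        ≈⟨ -‿+-comm _ _ ⟨
    - (suc m · 1#) - suc n · 1#        ∎

  ⟦+◃⟧ : ∀ n → ⟦ Sign.+ ℤ.◃ n ⟧ ≈ n · 1#
  ⟦+◃⟧ n = reflexive (≡.cong ⟦_⟧ (ℤ.+◃n≡+n n))

  ⟦-◃⟧ : ∀ n → ⟦ Sign.- ℤ.◃ n ⟧ ≈ - (n · 1#)
  ⟦-◃⟧ n = trans (reflexive (≡.cong ⟦_⟧ (ℤ.-◃n≡-n n))) (⟦-⟧ (+ n))

  ⟦*⟧ : ∀ i j → ⟦ i ℤ.* j ⟧ ≈ ⟦ i ⟧ * ⟦ j ⟧
  ⟦*⟧ (+ m)    (+ n)    = trans (⟦+◃⟧ (m ℕ.* n)) (×1-homo-* m n)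
  ⟦*⟧ (+ m)    -[1+ n ] = trans (⟦-◃⟧ (m ℕ.* suc n)) (trans (-‿cong (×1-homo-* m (suc n))) (-‿distribʳ-* _ _))
  ⟦*⟧ -[1+ m ] (+ n)    = trans (⟦-◃⟧ (suc m ℕ.* n)) (trans (-‿cong (×1-homo-* (suc m) n)) (-‿distribˡ-* _ _))
  ⟦*⟧ -[1+ m ] -[1+ n ] = begin
    ⟦ Sign.+ ℤ.◃ (suc m ℕ.* suc n) ⟧     ≈⟨ ⟦+◃⟧ (suc m ℕ.* suc n) ⟩
    (suc m ℕ.* suc n) · 1#               ≈⟨ ×1-homo-* (suc m) (suc n) ⟩
    suc m · 1# * suc n · 1#              ≈⟨ -‿involutive _ ⟨
    - - (suc m · 1# * suc n · 1#)        ≈⟨ -‿cong (-‿distribʳ-* _ _) ⟩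
    - (suc m · 1# * - (suc n · 1#))      ≈⟨ -‿distribˡ-* _ _ ⟩
    - (suc m · 1#) * - (suc n · 1#)      ∎

  ℤ-rawRing : RawRing 0ℓ 0ℓ
  ℤ-rawRing = record
    { Carrier = ℤ ; _≈_ = _≡_ ; _+_ = ℤ._+_ ; _*_ = ℤ._*_ ; -_ = ℤ.-_ ; 0# = + 0 ; 1# = + 1 }

  homomorphism : ℤ-rawRing -Raw-AlmostCommutative⟶ fromCommutativeRing R
  homomorphism = record
    { ⟦_⟧ = ⟦_⟧ ; +-homo = ⟦+⟧ ; *-homo = ⟦*⟧ ; -‿homo = ⟦-⟧ ; 0-homo = refl ; 1-homo = refl }

  ⟦⟧-≟ : WeaklyDecidable (λ i j → ⟦ i ⟧ ≈ ⟦ j ⟧)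
  ⟦⟧-≟ i j with i ℤ.≟ j
  ... | yes i≡j = just (reflexive (≡.cong ⟦_⟧ i≡j))
  ... | no  _   = nothing

  open RingSolver ℤ-rawRing (fromCommutativeRing R) homomorphism ⟦⟧-≟ public
    using (solve; con; _:=_; _:+_; _:*_; _:-_; :-_; _:^_)

-- Ordered field arithmetic, the Archimedean property and powers.

module OrderedField (em : ExcludedMiddle 0ℓ) (R : CompleteOrderedField) where

  open Benford em R
  open IsStrictTotalOrder isStrictTotalOrder public
    using (compare; isStrictPartialOrder)
    renaming (irrefl to <-irrefl; trans to <-trans; asym to <-asym)
  open IntegerCoefficients commutativeRing
  open SemiringMult semiring using (×-homo-+; ×1-homo-*)
  open SemiringExp semiring public using (_^_; ^-congˡ)

  <-strictPartialOrder : StrictPartialOrder 0ℓ 0ℓ 0ℓ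
  <-strictPartialOrder = record { isStrictPartialOrder = isStrictPartialOrder }

  module ≤-Reasoning = StrictPartialOrderReasoning <-strictPartialOrder
  open ≤-Reasoning

  private
    variable
      u v x y z w : ℝ

  <⇒≤ : x < y → x ≤ y
  <⇒≤ = inj₁

  ≤-reflexive : x ≈ y → x ≤ y
  ≤-reflexive = inj₂

  ≤-refl : x ≤ x
  ≤-refl = inj₂ refl

  ≤-trans : x ≤ y → y ≤ z → x ≤ z
  ≤-trans {x} {y} {z} p q = begin x ≤⟨ p ⟩ y ≤⟨ q ⟩ z ∎

  <-≤-trans : x < y → y ≤ z → x < z
  <-≤-trans {x} {y} {z} p q = begin-strict x <⟨ p ⟩ y ≤⟨ q ⟩ z ∎

  ≤-<-trans : x ≤ y → y < z → x < z
  ≤-<-trans {x} {y} {z} p q = begin-strict x ≤⟨ p ⟩ y <⟨ q ⟩ z ∎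

  <-resp-≈ : x ≈ u → y ≈ v → x < y → u < v
  <-resp-≈ {x} {u} {y} {v} p q r = begin-strict u ≈⟨ p ⟨ x <⟨ r ⟩ y ≈⟨ q ⟩ v ∎

  ≤-resp-≈ : x ≈ u → y ≈ v → x ≤ y → u ≤ v
  ≤-resp-≈ {x} {u} {y} {v} p q r = begin u ≈⟨ p ⟨ x ≤⟨ r ⟩ y ≈⟨ q ⟩ v ∎

  ≤⇒≯ : x ≤ y → ¬ y < x
  ≤⇒≯ p q = <-irrefl refl (≤-<-trans p q)

  ≮⇒≥ : ¬ x < y → y ≤ x
  ≮⇒≥ {x} {y} x≮y with compare x y
  ... | tri< x<y _ _ = contradiction x<y x≮y
  ... | tri≈ _ x≈y _ = inj₂ (sym x≈y)
  ... | tri> _ _ y<x = inj₁ y<x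

  <-or-≥ : ∀ x y → x < y ⊎ y ≤ x
  <-or-≥ x y with compare x y
  ... | tri< x<y _ _ = inj₁ x<y
  ... | tri≈ _ x≈y _ = inj₂ (inj₂ (sym x≈y))
  ... | tri> _ _ y<x = inj₂ (inj₁ y<x)

  ≤-antisym : x ≤ y → y ≤ x → x ≈ y
  ≤-antisym (inj₁ p) q = contradiction p (≤⇒≯ q)
  ≤-antisym (inj₂ p) q = p

  +-mono-< : x < y → u < v → x + u < y + v
  +-mono-< {x} {y} {u} {v} p q = begin-strict
    x + u  <⟨ +-monoˡ-< u p ⟩
    y + u  ≈⟨ +-comm y u ⟩
    u + y  <⟨ +-monoˡ-< y q ⟩
    v + y  ≈⟨ +-comm v y ⟩
    y + v  ∎

  +-mono-≤ : x ≤ y → u ≤ v → x + u ≤ y + v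
  +-mono-≤ (inj₁ p) (inj₁ q) = inj₁ (+-mono-< p q)
  +-mono-≤ {u = u} (inj₁ p) (inj₂ q) = inj₁ (<-resp-≈ refl (+-congˡ q) (+-monoˡ-< u p))
  +-mono-≤ {x} {y} {u} {v} (inj₂ p) (inj₁ q) =
    inj₁ (<-resp-≈ (+-comm u x) (trans (+-comm v x) (+-congʳ p)) (+-monoˡ-< x q))
  +-mono-≤ (inj₂ p) (inj₂ q) = inj₂ (+-cong p q)

  +-mono-<-≤ : x < y → u ≤ v → x + u < y + v
  +-mono-<-≤ p (inj₁ q) = +-mono-< p q
  +-mono-<-≤ {u = u} p (inj₂ q) = <-resp-≈ refl (+-congˡ q) (+-monoˡ-< u p)

  -- Linear inequalities are proved by transferring a known inequality along
  -- an identity between the differences of the two sides.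
  transfer-< : u < v → v - u ≈ y - x → x < y
  transfer-< {u} {v} {y} {x} p eq = <-resp-≈ (solve 2 (λ u x → u :+ (:- u :+ x) := x) refl u x)
    (trans (solve 3 (λ u v x → v :+ (:- u :+ x) := (v :- u) :+ x) refl u v x)
      (trans (+-congʳ eq) (solve 2 (λ x y → (y :- x) :+ x := y) refl x y)))
    (+-monoˡ-< (- u + x) p)

  transfer-≤ : u ≤ v → v - u ≈ y - x → x ≤ y
  transfer-≤ (inj₁ p) eq = inj₁ (transfer-< p eq)
  transfer-≤ {u} {v} {y} {x} (inj₂ p) eq = inj₂ (begin-equality
    x             ≈⟨ solve 2 (λ u x → x := (u :- u) :+ x) refl u x ⟩
    (u - u) + x   ≈⟨ +-congʳ (+-congʳ p) ⟩
    (v - u) + x   ≈⟨ +-congʳ eq ⟩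
    (y - x) + x   ≈⟨ solve 2 (λ x y → (y :- x) :+ x := y) refl x y ⟩
    y             ∎)

  x<y⇒0<y-x : x < y → 0# < y - x
  x<y⇒0<y-x {x} {y} p = transfer-< p (solve 2 (λ x y → y :- x := (y :- x) :- con (+ 0)) refl x y)

  x≤y⇒0≤y-x : x ≤ y → 0# ≤ y - x
  x≤y⇒0≤y-x {x} {y} p = transfer-≤ p (solve 2 (λ x y → y :- x := (y :- x) :- con (+ 0)) refl x y)

  neg-mono-< : x < y → - y < - x
  neg-mono-< {x} {y} p = transfer-< p (solve 2 (λ x y → y :- x := (:- x) :- (:- y)) refl x y)

  neg-mono-≤ : x ≤ y → - y ≤ - x
  neg-mono-≤ {x} {y} p = transfer-≤ p (solve 2 (λ x y → y :- x := (:- x) :- (:- y)) refl x y)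

  +-pos : 0# < x → 0# < y → 0# < x + y
  +-pos p q = <-resp-≈ (+-identityˡ 0#) refl (+-mono-< p q)

  +-nonneg : 0# ≤ x → 0# ≤ y → 0# ≤ x + y
  +-nonneg p q = ≤-resp-≈ (+-identityˡ 0#) refl (+-mono-≤ p q)

  *-nonneg : 0# ≤ x → 0# ≤ y → 0# ≤ x * y
  *-nonneg (inj₁ p) (inj₁ q) = inj₁ (*-pos p q)
  *-nonneg {x} {y} (inj₁ p) (inj₂ q) = inj₂ (trans (sym (zeroʳ x)) (*-congˡ q))
  *-nonneg {x} {y} (inj₂ p) _ = inj₂ (trans (sym (zeroˡ y)) (*-congʳ p))

  square-nonneg : ∀ x → 0# ≤ x * x
  square-nonneg x with <-or-≥ x 0#
  ... | inj₂ 0≤x = *-nonneg 0≤x 0≤x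
  ... | inj₁ x<0 = ≤-resp-≈ refl (solve 1 (λ x → (:- x) :* (:- x) := x :* x) refl x) (*-nonneg 0≤-x 0≤-x)
    where
    0≤-x : 0# ≤ - x
    0≤-x = transfer-≤ (<⇒≤ x<0) (solve 1 (λ x → con (+ 0) :- x := (:- x) :- con (+ 0)) refl x)

  *-monoʳ-< : 0# < z → x < y → z * x < z * y
  *-monoʳ-< {z} {x} {y} p q = transfer-< (*-pos p (x<y⇒0<y-x q))
    (solve 3 (λ x y z → z :* (y :- x) :- con (+ 0) := z :* y :- z :* x) refl x y z)

  *-monoʳ-≤ : 0# ≤ z → x ≤ y → z * x ≤ z * y
  *-monoʳ-≤ {z} {x} {y} p q = transfer-≤ (*-nonneg p (x≤y⇒0≤y-x q))
    (solve 3 (λ x y z → z :* (y :- x) :- con (+ 0) := z :* y :- z :* x) refl x y z)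

  *-monoˡ-≤ : 0# ≤ z → x ≤ y → x * z ≤ y * z
  *-monoˡ-≤ {z} {x} {y} p q = ≤-resp-≈ (*-comm z x) (*-comm z y) (*-monoʳ-≤ p q)

  *-mono-≤ : 0# ≤ x → 0# ≤ v → x ≤ y → u ≤ v → x * u ≤ y * v
  *-mono-≤ 0≤x 0≤v x≤y u≤v = ≤-trans (*-monoʳ-≤ 0≤x u≤v) (*-monoˡ-≤ 0≤v x≤y)

  *-cancelˡ-< : 0# ≤ z → z * x < z * y → x < y
  *-cancelˡ-< {z} {x} {y} p q with <-or-≥ x y
  ... | inj₁ x<y = x<y
  ... | inj₂ y≤x = contradiction q (≤⇒≯ (*-monoʳ-≤ p y≤x))

  *-cancelˡ-≤ : 0# < z → z * x ≤ z * y → x ≤ y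
  *-cancelˡ-≤ {z} {x} {y} p q with <-or-≥ y x
  ... | inj₁ y<x = contradiction (*-monoʳ-< p y<x) (≤⇒≯ q)
  ... | inj₂ x≤y = x≤y

  pos⇒≉0 : 0# < x → ¬ (x ≈ 0#)
  pos⇒≉0 p q = <-irrefl (sym q) p

  ⁻¹-inverse : 0# < x → x * x ⁻¹ ≈ 1#
  ⁻¹-inverse p = ⁻¹-inverseʳ (pos⇒≉0 p)

  ⁻¹-pos : 0# < x → 0# < x ⁻¹
  ⁻¹-pos {x} p = *-cancelˡ-< (<⇒≤ p) (<-resp-≈ (sym (zeroʳ x)) (sym (⁻¹-inverse p)) 0<1)

  *-cancelˡ-≈ : 0# < z → z * x ≈ z * y → x ≈ y
  *-cancelˡ-≈ p q = ≤-antisym (*-cancelˡ-≤ p (inj₂ q)) (*-cancelˡ-≤ p (inj₂ (sym q)))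

  ⁻¹-unique : 0# < x → x * y ≈ 1# → x ⁻¹ ≈ y
  ⁻¹-unique p q = *-cancelˡ-≈ p (trans (⁻¹-inverse p) (sym q))

  /-cancel : 0# < x → x * (y / x) ≈ y
  /-cancel {x} {y} p = begin-equality
    x * (y * x ⁻¹)  ≈⟨ solve 3 (λ x y z → x :* (y :* z) := y :* (x :* z)) refl x y (x ⁻¹) ⟩
    y * (x * x ⁻¹)  ≈⟨ *-congˡ (⁻¹-inverse p) ⟩
    y * 1#          ≈⟨ *-identityʳ y ⟩
    y               ∎

  /-pos : 0# < x → 0# < y → 0# < x / y
  /-pos p q = *-pos p (⁻¹-pos q)

  /-<⇒ : 0# < z → x / z < y → x < z * y
  /-<⇒ p q = <-resp-≈ (/-cancel p) refl (*-monoʳ-< p q)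

  </⇒ : 0# < z → x < y / z → z * x < y
  </⇒ p q = <-resp-≈ refl (/-cancel p) (*-monoʳ-< p q)

  ∣x∣<y⇒-y<x×x<y : ∀ x → ∣ x ∣ < y → - y < x × x < y
  ∣x∣<y⇒-y<x×x<y {y} x p with compare x 0#
  ... | tri< x<0 _ _ = <-resp-≈ refl (solve 1 (λ x → :- (:- x) := x) refl x) (neg-mono-< p) , <-trans x<0 (<-trans 0<-x p)
    where
    0<-x : 0# < - x
    0<-x = transfer-< x<0 (solve 1 (λ x → con (+ 0) :- x := (:- x) :- con (+ 0)) refl x)
  ... | tri≈ _ x≈0 _ = <-resp-≈ refl (sym x≈0) -y<0 , p
    where
    -y<0 : - y < 0#
    -y<0 = transfer-< (<-resp-≈ x≈0 refl p) (solve 1 (λ y → y :- con (+ 0) := con (+ 0) :- (:- y)) refl y)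
  ... | tri> _ _ 0<x = <-trans -y<0 0<x , p
    where
    -y<0 : - y < 0#
    -y<0 = transfer-< (<-trans 0<x p) (solve 1 (λ y → y :- con (+ 0) := con (+ 0) :- (:- y)) refl y)

  -y<x×x<y⇒∣x∣<y : ∀ x → - y < x → x < y → ∣ x ∣ < y
  -y<x×x<y⇒∣x∣<y {y} x p q with compare x 0#
  ... | tri< _ _ _ = <-resp-≈ refl (solve 1 (λ x → :- (:- x) := x) refl y) (neg-mono-< p)
  ... | tri≈ _ _ _ = q
  ... | tri> _ _ _ = q

  x≤∣x∣ : ∀ x → x ≤ ∣ x ∣
  x≤∣x∣ x with compare x 0#
  ... | tri< x<0 _ _ = <⇒≤ (<-trans x<0 (transfer-< x<0 (solve 1 (λ x → con (+ 0) :- x := (:- x) :- con (+ 0)) refl x)))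
  ... | tri≈ _ _ _ = ≤-refl
  ... | tri> _ _ _ = ≤-refl

  -x≤∣x∣ : ∀ x → - x ≤ ∣ x ∣
  -x≤∣x∣ x with compare x 0#
  ... | tri< x<0 _ _ = ≤-refl
  ... | tri≈ _ x≈0 _ = inj₂ (trans (-‿cong x≈0) (trans (solve 0 (:- con (+ 0) := con (+ 0)) refl) (sym x≈0)))
  ... | tri> _ _ 0<x = <⇒≤ (<-trans (transfer-< 0<x (solve 1 (λ x → x :- con (+ 0) := con (+ 0) :- (:- x)) refl x)) 0<x)

  ∣∣-nonneg : ∀ x → 0# ≤ ∣ x ∣
  ∣∣-nonneg x with compare x 0#
  ... | tri< x<0 _ _ = <⇒≤ (transfer-< x<0 (solve 1 (λ x → con (+ 0) :- x := (:- x) :- con (+ 0)) refl x))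
  ... | tri≈ _ x≈0 _ = inj₂ (sym x≈0)
  ... | tri> _ _ 0<x = <⇒≤ 0<x

  ∣pos∣ : 0# < x → ∣ x ∣ ≈ x
  ∣pos∣ {x} p with compare x 0#
  ... | tri< x<0 _ _ = contradiction x<0 (<-asym p)
  ... | tri≈ _ _ _ = refl
  ... | tri> _ _ _ = refl

  fromℕ-+ : ∀ m n → fromℕ (m ℕ.+ n) ≈ fromℕ m + fromℕ n
  fromℕ-+ = ×-homo-+ 1#

  fromℕ-* : ∀ m n → fromℕ (m ℕ.* n) ≈ fromℕ m * fromℕ n
  fromℕ-* = ×1-homo-*

  fromℕ-nonneg : ∀ n → 0# ≤ fromℕ n
  fromℕ-nonneg zero    = ≤-refl
  fromℕ-nonneg (suc n) = +-nonneg (<⇒≤ 0<1) (fromℕ-nonneg n)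

  fromℕ-mono-≤ : ∀ {m n} → m ℕ.≤ n → fromℕ m ≤ fromℕ n
  fromℕ-mono-≤ {n = n} z≤n = fromℕ-nonneg n
  fromℕ-mono-≤ (s≤s p)     = +-mono-≤ ≤-refl (fromℕ-mono-≤ p)

  fromℕ-mono-< : ∀ {m n} → m ℕ.< n → fromℕ m < fromℕ n
  fromℕ-mono-< {m} {n} p = <-≤-trans
    (transfer-< 0<1 (solve 1 (λ x → con (+ 1) :- con (+ 0) := (con (+ 1) :+ x) :- x) refl (fromℕ m)))
    (fromℕ-mono-≤ p)

  fromℕ-pos : ∀ {n} → 1 ℕ.≤ n → 0# < fromℕ n
  fromℕ-pos = fromℕ-mono-<

  fromℕ-1 : fromℕ 1 ≈ 1#
  fromℕ-1 = +-identityʳ 1#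

  -- If the natural numbers were bounded, their supremum `s` would satisfy n + 1 ≤ s for every n, so
  -- s - 1 would be a smaller upper bound.
  archimedean : ∀ x → ∃[ n ] (x < fromℕ n)
  archimedean x with em {∃[ n ] (x < fromℕ n)}
  ... | yes p = p
  ... | no ¬p = contradiction s≤s-1 (≤⇒≯′)
    where
    S : ℝ → Set
    S y = ∃[ n ] (y ≈ fromℕ n)
    bounded : UpperBound S x
    bounded y (n , y≈n) = ≮⇒≥ λ x<y → ¬p (n , <-resp-≈ refl y≈n x<y)
    s = lub S (0# , 0 , refl) (x , bounded)
    s-1-bound : UpperBound S (proj₁ s - 1#)
    s-1-bound y (n , y≈n) = transfer-≤ (proj₁ (proj₂ s) (fromℕ (suc n)) (suc n , refl))
      (trans (solve 2 (λ s n → s :- (con (+ 1) :+ n) := (s :- con (+ 1)) :- n) refl (proj₁ s) (fromℕ n))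
        (+-congˡ (-‿cong (sym y≈n))))
    s≤s-1 : proj₁ s ≤ proj₁ s - 1#
    s≤s-1 = proj₂ (proj₂ s) _ s-1-bound
    ≤⇒≯′ : ¬ (proj₁ s ≤ proj₁ s - 1#)
    ≤⇒≯′ p = ≤⇒≯ p (transfer-< 0<1 (solve 1 (λ s → con (+ 1) :- con (+ 0) := s :- (s :- con (+ 1))) refl (proj₁ s)))

  ^-nonneg : ∀ n → 0# ≤ x → 0# ≤ x ^ n
  ^-nonneg zero    p = <⇒≤ 0<1
  ^-nonneg (suc n) p = *-nonneg p (^-nonneg n p)

  ^-pos : ∀ n → 0# < x → 0# < x ^ n
  ^-pos zero    p = 0<1
  ^-pos (suc n) p = *-pos p (^-pos n p)

  ^-monoˡ-≤ : ∀ n → 0# ≤ x → x ≤ y → x ^ n ≤ y ^ n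
  ^-monoˡ-≤ zero    p q = ≤-refl
  ^-monoˡ-≤ (suc n) p q = *-mono-≤ p (^-nonneg n (≤-trans p q)) q (^-monoˡ-≤ n p q)

  1^n≈1 : ∀ n → 1# ^ n ≈ 1#
  1^n≈1 zero    = refl
  1^n≈1 (suc n) = trans (*-identityˡ _) (1^n≈1 n)

  ^-distrib-* : ∀ x y n → (x * y) ^ n ≈ x ^ n * y ^ n
  ^-distrib-* x y zero    = sym (*-identityˡ 1#)
  ^-distrib-* x y (suc n) = trans (*-congˡ (^-distrib-* x y n))
    (solve 4 (λ x y p q → (x :* y) :* (p :* q) := (x :* p) :* (y :* q)) refl x y (x ^ n) (y ^ n))

  -- The weighted AM–GM inequality; a = 1 is Bernoulli's inequality.
  bernoulli : ∀ n a b → 0# < a → 0# ≤ b → a ^ n * (fromℕ (suc n) * b - fromℕ n * a) ≤ b ^ suc n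
  bernoulli zero a b 0<a 0≤b = ≤-reflexive
    (solve 2 (λ a b → con (+ 1) :* ((con (+ 1) :+ con (+ 0)) :* b :- con (+ 0) :* a) := b :* con (+ 1)) refl a b)
  bernoulli (suc n) a b 0<a 0≤b = ≤-trans
    -- The inequality for n, multiplied by b, exceeds the one for n + 1 on its left side by (n + 1)
    -- aⁿ (b - a)².
    (transfer-≤ (*-nonneg (*-nonneg (fromℕ-nonneg (suc n)) (^-nonneg n (<⇒≤ 0<a))) (square-nonneg (b - a)))
      (solve 4 (λ a b n p → ((con (+ 1) :+ n) :* p) :* ((b :- a) :* (b :- a)) :- con (+ 0) :=
                 b :* (p :* ((con (+ 1) :+ n) :* b :- n :* a)) :-
                 (a :* p) :* ((con (+ 1) :+ (con (+ 1) :+ n)) :* b :- (con (+ 1) :+ n) :* a))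
        refl a b (fromℕ n) (a ^ n)))
    (*-monoʳ-≤ 0≤b (bernoulli n a b 0<a 0≤b))

-- The exponential function and the logarithm.

module Exponential (em : ExcludedMiddle 0ℓ) (R : CompleteOrderedField) where

  open Benford em R
  open OrderedField em R
  open ≤-Reasoning
  open IntegerCoefficients commutativeRing

  half : ∀ {d} → 0# < d → ∃[ h ] (0# < h × h + h ≈ d)
  half {d} 0<d = d / fromℕ 2 , /-pos 0<d 0<2 , trans
    (solve 1 (λ h → h :+ h := (con (+ 1) :+ (con (+ 1) :+ con (+ 0))) :* h) refl (d / fromℕ 2))
    (/-cancel 0<2)
    where
    0<2 : 0# < fromℕ 2
    0<2 = fromℕ-pos {2} (s≤s z≤n)

  ≤-by-ε : ∀ {x y} → (∀ ε → 0# < ε → x ≤ y + ε) → x ≤ y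
  ≤-by-ε {x} {y} p = ≮⇒≥ λ y<x → let
      h , 0<h , h+h≈d = half (x<y⇒0<y-x y<x)
    in ≤⇒≯ (p h 0<h) (transfer-< 0<h (trans (solve 1 (λ h → h :- con (+ 0) := (h :+ h) :- h) refl h)
         (trans (+-congʳ h+h≈d) (solve 3 (λ x y h → (x :- y) :- h := x :- (y :+ h)) refl x y h))))

  ⟶-unique : ∀ {s l m} → s ⟶ l → s ⟶ m → l ≤ m
  ⟶-unique {s} {l} {m} p q = ≤-by-ε λ ε 0<ε → let
      h , 0<h , h+h≈ε = half 0<ε
      M , pM = p h 0<h
      N , qN = q h 0<h
      n = M ℕ.⊔ N
      a = proj₁ (∣x∣<y⇒-y<x×x<y _ (pM n (ℕ.m≤m⊔n M N)))
      b = proj₂ (∣x∣<y⇒-y<x×x<y _ (qN n (ℕ.m≤n⊔m M N)))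
    in <⇒≤ (transfer-< (+-mono-< a b) (trans
         (solve 4 (λ s l m h → ((s :- l) :+ h) :- (:- h :+ (s :- m)) := (m :+ (h :+ h)) :- l) refl (s n) l m h)
         (+-congʳ (+-congˡ h+h≈ε))))

  lim-≈ : ∀ {s l} → s ⟶ l → lim s ≈ l
  lim-≈ {s} p with em {∃[ l ] (s ⟶ l)}
  ... | yes (m , q) = ≤-antisym (⟶-unique q p) (⟶-unique p q)
  ... | no ¬q       = contradiction (_ , p) ¬q

  module _ (s : ℕ → ℝ) (N : ℕ) (s-mono : ∀ {m n} → N ℕ.≤ m → m ℕ.≤ n → s m ≤ s n)
           {B : ℝ} (s≤B : ∀ n → N ℕ.≤ n → s n ≤ B) where

    private
      Tail : ℝ → Set
      Tail x = ∃[ n ] (N ℕ.≤ n × x ≈ s n)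

      sup : ∃[ l ] (UpperBound Tail l × (∀ u → UpperBound Tail u → l ≤ u))
      sup = lub Tail (s N , N , ℕ.≤-refl , refl) (B , λ { x (n , N≤n , x≈sn) → ≤-trans (≤-reflexive x≈sn) (s≤B n N≤n) })

    tail-sup : ℝ
    tail-sup = proj₁ sup

    tail-sup-upper : ∀ n → N ℕ.≤ n → s n ≤ tail-sup
    tail-sup-upper n N≤n = proj₁ (proj₂ sup) (s n) (n , N≤n , refl)

    tail-sup-least : ∀ u → (∀ n → N ℕ.≤ n → s n ≤ u) → tail-sup ≤ u
    tail-sup-least u p = proj₂ (proj₂ sup) u λ { x (n , N≤n , x≈sn) → ≤-trans (≤-reflexive x≈sn) (p n N≤n) }

    monotone-⟶ : s ⟶ tail-sup
    monotone-⟶ ε 0<ε with em {∃[ n ] (N ℕ.≤ n × tail-sup - ε < s n)}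
    ... | yes (M , N≤M , p) = M , λ n M≤n → -y<x×x<y⇒∣x∣<y _
        (transfer-< (<-≤-trans p (s-mono N≤M M≤n))
          (solve 3 (λ x l e → x :- (l :- e) := (x :- l) :- (:- e)) refl (s n) tail-sup ε))
        (≤-<-trans (transfer-≤ (tail-sup-upper n (ℕ.≤-trans N≤M M≤n))
          (solve 2 (λ x l → l :- x := con (+ 0) :- (x :- l)) refl (s n) tail-sup)) 0<ε)
    ... | no ¬p = contradiction
        (transfer-< 0<ε (solve 2 (λ l e → e :- con (+ 0) := l :- (l :- e)) refl tail-sup ε))
        (≤⇒≯ (tail-sup-least (tail-sup - ε) λ n N≤n → ≮⇒≥ λ q → ¬p (n , N≤n , q)))

  -- Monotonicity in n can only be expected once n + y is positive: for y = -3 the first values are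
  -- -2, 1/4, 0. This is why limits are taken over tails and why 0 < n + y accompanies the lemmas on
  -- `e`.
  e : ℕ → ℝ → ℝ
  e n y = (1# + y / fromℕ n) ^ n

  module _ (n : ℕ) (1≤n : 1 ℕ.≤ n) (y : ℝ) where

    n*factor : fromℕ n * (1# + y / fromℕ n) ≈ fromℕ n + y
    n*factor = trans (distribˡ _ _ _) (+-cong (*-identityʳ _) (/-cancel (fromℕ-pos 1≤n)))

    factor-pos : 0# < fromℕ n + y → 0# < 1# + y / fromℕ n
    factor-pos p = *-cancelˡ-< (fromℕ-nonneg n) (<-resp-≈ (sym (zeroʳ _)) (sym n*factor) p)

  n+y-mono : ∀ {m n y} → m ℕ.≤ n → 0# < fromℕ m + y → 0# < fromℕ n + y
  n+y-mono m≤n p = <-≤-trans p (+-mono-≤ (fromℕ-mono-≤ m≤n) ≤-refl)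

  e-pos : ∀ {n y} → 1 ℕ.≤ n → 0# < fromℕ n + y → 0# < e n y
  e-pos {n} 1≤n p = ^-pos n (factor-pos n 1≤n _ p)

  -- AM-GM for a = 1 + y/n and b = 1 + y/(n+1): the bracket (n + 1) b - n a equals (n + 1 + y) - (n
  -- + y) = 1.
  e-step : ∀ {n y} → 1 ℕ.≤ n → 0# < fromℕ n + y → e n y ≤ e (suc n) y
  e-step {n} {y} 1≤n p = ≤-trans (≤-reflexive (begin-equality
    a ^ n                                        ≈⟨ *-identityʳ _ ⟨
    a ^ n * 1#                                   ≈⟨ *-congˡ (solve 2 (λ n y → con (+ 1) := (con (+ 1) :+ n :+ y) :- (n :+ y)) refl (fromℕ n) y) ⟩
    a ^ n * ((fromℕ (suc n) + y) - (fromℕ n + y)) ≈⟨ *-congˡ (+-cong (n*factor (suc n) (s≤s z≤n) y) (-‿cong (n*factor n 1≤n y))) ⟨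
    a ^ n * (fromℕ (suc n) * b - fromℕ n * a)     ∎))
    (bernoulli n a b (factor-pos n 1≤n y p) (<⇒≤ (factor-pos (suc n) (s≤s z≤n) y (n+y-mono (ℕ.n≤1+n n) p))))
    where
    a = 1# + y / fromℕ n
    b = 1# + y / fromℕ (suc n)

  e-mono : ∀ {m n y} → 1 ℕ.≤ m → 0# < fromℕ m + y → m ℕ.≤ n → e m y ≤ e n y
  e-mono {m} {y = y} 1≤m p m≤n = go (ℕ.≤⇒≤′ m≤n)
    where
    go : ∀ {n} → m ℕ.≤′ n → e m y ≤ e n y
    go (ℕ.≤′-reflexive ≡.refl) = ≤-refl
    go (ℕ.≤′-step m≤′n) = ≤-trans (go m≤′n)
      (e-step (ℕ.≤-trans 1≤m (ℕ.≤′⇒≤ m≤′n)) (n+y-mono (ℕ.≤′⇒≤ m≤′n) p))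

  -- At a common index k the product is (1 - y²/k²)ᵏ ≤ 1. This bounds `e n y` by the inverse of a
  -- fixed `e N (- y)`, so that the increasing tail converges.
  e*e-neg≤1 : ∀ {m n y} → 1 ℕ.≤ m → 0# < fromℕ m + y → 1 ℕ.≤ n → 0# < fromℕ n - y → e m y * e n (- y) ≤ 1#
  e*e-neg≤1 {m} {n} {y} 1≤m p 1≤n q = begin
    e m y * e n (- y)         ≤⟨ *-mono-≤ (<⇒≤ (e-pos 1≤m p)) (<⇒≤ (e-pos 1≤k q′)) (e-mono 1≤m p m≤k) (e-mono 1≤n q n≤k) ⟩
    e k y * e k (- y)         ≈⟨ ^-distrib-* _ _ k ⟨
    ((1# + y / fromℕ k) * (1# + (- y) / fromℕ k)) ^ k
                              ≤⟨ ^-monoˡ-≤ k (*-nonneg (<⇒≤ (factor-pos k 1≤k y p′)) (<⇒≤ (factor-pos k 1≤k (- y) q′)))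
                                   (transfer-≤ (square-nonneg (y / fromℕ k))
                                     (solve 2 (λ y k → (y :* k) :* (y :* k) :- con (+ 0) :=
                                         con (+ 1) :- (con (+ 1) :+ y :* k) :* (con (+ 1) :+ (:- y) :* k)) refl y (fromℕ k ⁻¹))) ⟩
    1# ^ k                    ≈⟨ 1^n≈1 k ⟩
    1#                        ∎
    where
    k = m ℕ.⊔ n
    m≤k = ℕ.m≤m⊔n m n
    n≤k = ℕ.m≤n⊔m m n
    1≤k = ℕ.≤-trans 1≤m m≤k
    p′ : 0# < fromℕ k + y
    p′ = n+y-mono m≤k p
    q′ : 0# < fromℕ k - y
    q′ = n+y-mono n≤k q

  *≤1⇒≤⁻¹ : ∀ {x y} → 0# < x → y * x ≤ 1# → y ≤ x ⁻¹
  *≤1⇒≤⁻¹ {x} {y} p q = *-cancelˡ-≤ p (≤-resp-≈ (*-comm y x) (sym (⁻¹-inverse p)) q)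

  ≤⁻¹⇒*≤1 : ∀ {x y} → 0# < x → y ≤ x ⁻¹ → x * y ≤ 1#
  ≤⁻¹⇒*≤1 p q = ≤-trans (*-monoʳ-≤ (<⇒≤ p) q) (≤-reflexive (⁻¹-inverse p))

  beyond : ∀ y → ∃[ n ] (1 ℕ.≤ n × 0# < fromℕ n + y × 0# < fromℕ n - y)
  beyond y with archimedean ∣ y ∣
  ... | n , ∣y∣<n = suc n , s≤s z≤n ,
      ≤-<-trans 0≤∣y∣+y (+-mono-<-≤ ∣y∣<1+n ≤-refl) ,
      ≤-<-trans 0≤∣y∣-y (+-mono-<-≤ ∣y∣<1+n ≤-refl)
    where
    ∣y∣<1+n : ∣ y ∣ < fromℕ (suc n)
    ∣y∣<1+n = <-trans ∣y∣<n (fromℕ-mono-< (ℕ.n<1+n n))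
    0≤∣y∣+y : 0# ≤ ∣ y ∣ + y
    0≤∣y∣+y = transfer-≤ (-x≤∣x∣ y) (solve 2 (λ a y → a :- (:- y) := (a :+ y) :- con (+ 0)) refl ∣ y ∣ y)
    0≤∣y∣-y : 0# ≤ ∣ y ∣ - y
    0≤∣y∣-y = x≤y⇒0≤y-x (x≤∣x∣ y)

  module _ (y : ℝ) where

    private
      N = proj₁ (beyond y)
      1≤N = proj₁ (proj₂ (beyond y))
      0<N+y = proj₁ (proj₂ (proj₂ (beyond y)))
      0<N-y = proj₂ (proj₂ (proj₂ (beyond y)))

      tail-mono : ∀ {m n} → N ℕ.≤ m → m ℕ.≤ n → e m y ≤ e n y
      tail-mono N≤m = e-mono (ℕ.≤-trans 1≤N N≤m) (n+y-mono N≤m 0<N+y)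

      bounded : ∀ n → N ℕ.≤ n → e n y ≤ (e N (- y)) ⁻¹
      bounded n N≤n = *≤1⇒≤⁻¹ (e-pos 1≤N 0<N-y)
        (e*e-neg≤1 (ℕ.≤-trans 1≤N N≤n) (n+y-mono N≤n 0<N+y) 1≤N 0<N-y)

      exp≈ : exp y ≈ tail-sup (λ n → e n y) N tail-mono bounded
      exp≈ = lim-≈ (monotone-⟶ (λ n → e n y) N tail-mono bounded)

    e≤exp : ∀ {n} → 1 ℕ.≤ n → 0# < fromℕ n + y → e n y ≤ exp y
    e≤exp {n} 1≤n p = begin
      e n y           ≤⟨ e-mono 1≤n p (ℕ.m≤m⊔n n N) ⟩
      e (n ℕ.⊔ N) y   ≤⟨ tail-sup-upper _ N tail-mono bounded (n ℕ.⊔ N) (ℕ.m≤n⊔m n N) ⟩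
      tail-sup _ N tail-mono bounded ≈⟨ exp≈ ⟨
      exp y           ∎

    -- Together with `e≤exp`, this exhibits `exp y` as a supremum. The properties of `exp` below
    -- rest on these two facts, with no further passage to the limit.
    exp-least : ∀ M u → (∀ n → M ℕ.≤ n → 1 ℕ.≤ n → 0# < fromℕ n + y → e n y ≤ u) → exp y ≤ u
    exp-least M u p = ≤-trans (≤-reflexive exp≈) (tail-sup-least _ N tail-mono bounded u λ n N≤n → begin
      e n y           ≤⟨ tail-mono N≤n (ℕ.m≤m⊔n n M) ⟩
      e (n ℕ.⊔ M) y   ≤⟨ p (n ℕ.⊔ M) (ℕ.m≤n⊔m n M) (ℕ.≤-trans 1≤N (ℕ.≤-trans N≤n (ℕ.m≤m⊔n n M)))
                           (n+y-mono (ℕ.≤-trans N≤n (ℕ.m≤m⊔n n M)) 0<N+y) ⟩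
      u               ∎)

    exp-pos : 0# < exp y
    exp-pos = <-≤-trans (e-pos 1≤N 0<N+y) (e≤exp 1≤N 0<N+y)

  exp-cong : ∀ {x y} → x ≈ y → exp x ≈ exp y
  exp-cong p = ≤-antisym (one-way p) (one-way (sym p))
    where
    one-way : ∀ {x y} → x ≈ y → exp x ≤ exp y
    one-way {x} {y} x≈y = exp-least x 0 (exp y) λ n _ 1≤n p →
      ≤-trans (≤-reflexive (^-congˡ n (+-congˡ (*-congʳ x≈y))))
        (e≤exp y 1≤n (<-resp-≈ refl (+-congˡ x≈y) p))

  exp*exp-neg≤1 : ∀ y → exp y * exp (- y) ≤ 1#
  exp*exp-neg≤1 y = ≤⁻¹⇒*≤1 (exp-pos y) (exp-least (- y) 0 _ λ m _ 1≤m q →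
    *≤1⇒≤⁻¹ (exp-pos y) (≤⁻¹⇒*≤1 (e-pos 1≤m q) (exp-least y 0 _ λ n _ 1≤n p →
      *≤1⇒≤⁻¹ (e-pos 1≤m q) (e*e-neg≤1 1≤n p 1≤m q))))

  -- With A = (1 + x/n)(1 + y/n) and B = 1 + (x + y)/n, the inequality
  -- Aⁿ ≥ Bⁿ⁻¹ (n A - (n-1) B) reads Bⁿ ≤ Aⁿ - Bⁿ⁻¹ xy/n, and the last term
  -- is small because B ≥ 1/2.
  e-+-≤ : ∀ m x y ε → let n = suc m in
          0# < fromℕ n + x → 0# < fromℕ n + y → 0# < fromℕ n + (x + y) → 0# < fromℕ n + (x + y + (x + y)) →
          exp (x + y) * (fromℕ 2 * ∣ x * y ∣) ≤ fromℕ n * ε →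
          e n (x + y) ≤ exp x * exp y + ε
  e-+-≤ m x y ε 0<n+x 0<n+y 0<n+x+y p small = begin
    B * B ^ m                      ≈⟨ *-comm B _ ⟩
    B ^ m * B                      ≈⟨ solve 4 (λ b q i c → q :* b := q :* (b :+ (c :* i) :* con (+ 1)) :+ (:- c) :* (q :* i)) refl B (B ^ m) i (x * y) ⟩
    B ^ m * (B + x * y * i * 1#) + - (x * y) * (B ^ m * i)
                                   ≈⟨ +-congʳ (*-congˡ (+-congˡ (*-congˡ n*i≈1))) ⟨
    B ^ m * (B + x * y * i * (fromℕ n * i)) + - (x * y) * (B ^ m * i)
                                   ≈⟨ +-congʳ (*-congˡ (solve 4 (λ x y i m →
                                        (con (+ 1) :+ (x :+ y) :* i) :+ x :* y :* i :* ((con (+ 1) :+ m) :* i) :=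
                                        (con (+ 1) :+ m) :* ((con (+ 1) :+ x :* i) :* (con (+ 1) :+ y :* i)) :- m :* (con (+ 1) :+ (x :+ y) :* i))
                                      refl x y i (fromℕ m))) ⟩
    B ^ m * (fromℕ n * A - fromℕ m * B) + - (x * y) * (B ^ m * i)
                                   ≤⟨ +-mono-≤ (bernoulli m B A 0<B 0≤A) (*-monoˡ-≤ (<⇒≤ (*-pos (^-pos m 0<B) 0<i)) (-x≤∣x∣ (x * y))) ⟩
    A ^ n + ∣ x * y ∣ * (B ^ m * i) ≤⟨ +-mono-≤ ≤-refl remainder ⟩
    A ^ n + ε                      ≈⟨ +-congʳ (^-distrib-* _ _ n) ⟩
    e n x * e n y + ε              ≤⟨ +-mono-≤ (*-mono-≤ (<⇒≤ (e-pos 1≤n 0<n+x)) (<⇒≤ (exp-pos y)) (e≤exp x 1≤n 0<n+x) (e≤exp y 1≤n 0<n+y)) ≤-refl ⟩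
    exp x * exp y + ε              ∎
    where
    n = suc m
    1≤n : 1 ℕ.≤ n
    1≤n = s≤s z≤n
    i = fromℕ n ⁻¹
    A = (1# + x / fromℕ n) * (1# + y / fromℕ n)
    B = 1# + (x + y) / fromℕ n
    0<n : 0# < fromℕ n
    0<n = fromℕ-pos {n} 1≤n
    0<i : 0# < i
    0<i = ⁻¹-pos 0<n
    n*i≈1 : fromℕ n * i ≈ 1#
    n*i≈1 = ⁻¹-inverse 0<n
    0<B : 0# < B
    0<B = factor-pos n 1≤n (x + y) 0<n+x+y
    0≤A : 0# ≤ A
    0≤A = *-nonneg (<⇒≤ (factor-pos n 1≤n x 0<n+x)) (<⇒≤ (factor-pos n 1≤n y 0<n+y))
    1≤2B : 1# ≤ fromℕ 2 * B
    1≤2B = *-cancelˡ-≤ 0<n (begin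
      fromℕ n * 1#              ≤⟨ transfer-≤ (<⇒≤ p) (solve 2 (λ n s →
                                     n :+ (s :+ s) :- con (+ 0) := (con (+ 1) :+ (con (+ 1) :+ con (+ 0))) :* (n :+ s) :- n :* con (+ 1)) refl (fromℕ n) (x + y)) ⟩
      fromℕ 2 * (fromℕ n + (x + y)) ≈⟨ *-congˡ (n*factor n 1≤n (x + y)) ⟨
      fromℕ 2 * (fromℕ n * B)   ≈⟨ solve 3 (λ a b c → a :* (b :* c) := b :* (a :* c)) refl (fromℕ 2) (fromℕ n) B ⟩
      fromℕ n * (fromℕ 2 * B)   ∎)
    0≤∣xy∣ : 0# ≤ ∣ x * y ∣
    0≤∣xy∣ = ∣∣-nonneg (x * y)
    -- As 1 ≤ 2 B, the power Bᵐ is at most 2 Bⁿ, and Bⁿ is an approximant of `exp (x + y)`; the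
    -- factor 1/n then makes the term small.
    remainder : ∣ x * y ∣ * (B ^ m * i) ≤ ε
    remainder = *-cancelˡ-≤ 0<n (begin
      fromℕ n * (∣ x * y ∣ * (B ^ m * i))  ≈⟨ solve 4 (λ n i c q → n :* (c :* (q :* i)) := (c :* q) :* (n :* i)) refl (fromℕ n) i ∣ x * y ∣ (B ^ m) ⟩
      (∣ x * y ∣ * B ^ m) * (fromℕ n * i)  ≈⟨ *-congˡ n*i≈1 ⟩
      (∣ x * y ∣ * B ^ m) * 1#             ≤⟨ *-monoʳ-≤ (*-nonneg 0≤∣xy∣ (^-nonneg m (<⇒≤ 0<B))) 1≤2B ⟩
      (∣ x * y ∣ * B ^ m) * (fromℕ 2 * B)  ≈⟨ solve 4 (λ c q d b → (c :* q) :* (d :* b) := (b :* q) :* (d :* c)) refl ∣ x * y ∣ (B ^ m) (fromℕ 2) B ⟩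
      B ^ n * (fromℕ 2 * ∣ x * y ∣)        ≤⟨ *-monoˡ-≤ (*-nonneg (fromℕ-nonneg 2) 0≤∣xy∣) (e≤exp (x + y) 1≤n 0<n+x+y) ⟩
      exp (x + y) * (fromℕ 2 * ∣ x * y ∣)  ≤⟨ small ⟩
      fromℕ n * ε                          ∎)

  exp-+-≤ : ∀ x y → exp (x + y) ≤ exp x * exp y
  exp-+-≤ x y = ≤-by-ε λ ε 0<ε → let
      c = exp (x + y) * (fromℕ 2 * ∣ x * y ∣)
      N , c/ε<N = archimedean (c / ε)
      N₁ , _ , p₁ , _ = beyond x
      N₂ , _ , p₂ , _ = beyond y
      N₃ , _ , p₃ , _ = beyond (x + y)
      N₄ , _ , p₄ , _ = beyond (x + y + (x + y))
      large = λ n (q : N ℕ.+ (N₁ ℕ.+ (N₂ ℕ.+ (N₃ ℕ.+ N₄))) ℕ.≤ n) → (let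
        q₁ = ℕ.m+n≤o⇒n≤o N q
        q₂ = ℕ.m+n≤o⇒n≤o N₁ q₁
        q₃ = ℕ.m+n≤o⇒n≤o N₂ q₂
        in ℕ.m+n≤o⇒m≤o N q , ℕ.m+n≤o⇒m≤o N₁ q₁ , ℕ.m+n≤o⇒m≤o N₂ q₂ , ℕ.m+n≤o⇒m≤o N₃ q₃ , ℕ.m+n≤o⇒n≤o N₃ q₃)
    in exp-least (x + y) (N ℕ.+ (N₁ ℕ.+ (N₂ ℕ.+ (N₃ ℕ.+ N₄)))) _ λ where
         zero    _ () _
         (suc m) q _ _ → let
             q₀ , q₁ , q₂ , q₃ , q₄ = large (suc m) q
           in e-+-≤ m x y ε (n+y-mono q₁ p₁) (n+y-mono q₂ p₂) (n+y-mono q₃ p₃) (n+y-mono q₄ p₄)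
                (≤-resp-≈ refl (*-comm ε _)
                  (<⇒≤ (/-<⇒ 0<ε (<-≤-trans c/ε<N (fromℕ-mono-≤ q₀)))))

  -- The missing direction follows from the known one for x + y and -y: exp x ≤ exp (x + y) exp
  -- (-y), and exp y exp (-y) ≤ 1.
  exp-+ : ∀ x y → exp (x + y) ≈ exp x * exp y
  exp-+ x y = ≤-antisym (exp-+-≤ x y) (begin
    exp x * exp y                       ≈⟨ *-congʳ (exp-cong (solve 2 (λ x y → x := (x :+ y) :+ (:- y)) refl x y)) ⟩
    exp (x + y - y) * exp y             ≤⟨ *-monoˡ-≤ (<⇒≤ (exp-pos y)) (exp-+-≤ (x + y) (- y)) ⟩
    exp (x + y) * exp (- y) * exp y     ≈⟨ solve 3 (λ a b c → a :* b :* c := a :* (c :* b)) refl (exp (x + y)) (exp (- y)) (exp y) ⟩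
    exp (x + y) * (exp y * exp (- y))   ≤⟨ *-monoʳ-≤ (<⇒≤ (exp-pos (x + y))) (exp*exp-neg≤1 y) ⟩
    exp (x + y) * 1#                    ≈⟨ *-identityʳ _ ⟩
    exp (x + y)                         ∎)

  -- The left side is the approximant with n = 1.
  1+x≤exp : ∀ {x} → 0# < 1# + x → 1# + x ≤ exp x
  1+x≤exp {x} p = ≤-trans (≤-reflexive (begin-equality
    1# + x                         ≈⟨ +-congʳ fromℕ-1 ⟨
    fromℕ 1 + x                    ≈⟨ n*factor 1 ℕ.≤-refl x ⟨
    fromℕ 1 * (1# + x / fromℕ 1)   ≈⟨ *-congʳ fromℕ-1 ⟩
    1# * (1# + x / fromℕ 1)        ≈⟨ *-comm _ _ ⟩
    (1# + x / fromℕ 1) * 1#        ∎))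
    (e≤exp x ℕ.≤-refl (<-resp-≈ refl (+-congʳ (sym fromℕ-1)) p))

  exp-0 : exp 0# ≈ 1#
  exp-0 = *-cancelˡ-≈ (exp-pos 0#) (begin-equality
    exp 0# * exp 0#  ≈⟨ exp-+ 0# 0# ⟨
    exp (0# + 0#)    ≈⟨ exp-cong (+-identityˡ 0#) ⟩
    exp 0#           ≈⟨ *-identityʳ _ ⟨
    exp 0# * 1#      ∎)

  exp*exp-neg : ∀ y → exp y * exp (- y) ≈ 1#
  exp*exp-neg y = trans (sym (exp-+ y (- y))) (trans (exp-cong (-‿inverseʳ y)) exp-0)

  exp-mono-< : ∀ {x y} → x < y → exp x < exp y
  exp-mono-< {x} {y} x<y = begin-strict
    exp x                ≈⟨ *-identityʳ _ ⟨
    exp x * 1#           <⟨ *-monoʳ-< (exp-pos x) (<-≤-trans 1<1+d (1+x≤exp (<-trans 0<1 1<1+d))) ⟩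
    exp x * exp (y - x)  ≈⟨ exp-+ x (y - x) ⟨
    exp (x + (y - x))    ≈⟨ exp-cong (solve 2 (λ x y → x :+ (y :- x) := y) refl x y) ⟩
    exp y                ∎
    where
    1<1+d : 1# < 1# + (y - x)
    1<1+d = transfer-< x<y (solve 2 (λ x y → y :- x := (con (+ 1) :+ (y :- x)) :- con (+ 1)) refl x y)

  exp-mono-≤ : ∀ {x y} → x ≤ y → exp x ≤ exp y
  exp-mono-≤ (inj₁ p) = <⇒≤ (exp-mono-< p)
  exp-mono-≤ (inj₂ p) = ≤-reflexive (exp-cong p)

  exp-cancel-< : ∀ {x y} → exp x < exp y → x < y
  exp-cancel-< {x} {y} p with <-or-≥ x y
  ... | inj₁ x<y = x<y
  ... | inj₂ y≤x = contradiction p (≤⇒≯ (exp-mono-≤ y≤x))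

  -- The solution is s = sup of all y with exp y ≤ x. Continuity is replaced by the inequality 1 - h
  -- ≤ exp (-h): if exp s and x differed, with ratio r < 1, then h = 1 - r would be an explicit
  -- amount by which s could be raised within the set or lowered as an upper bound.
  exp-surjective : ∀ {x} → 0# < x → ∃[ y ] (exp y ≈ x)
  exp-surjective {x} 0<x = s , exp-s≈x
    where
    S : ℝ → Set
    S y = exp y ≤ x

    nonempty : S (- (x ⁻¹))
    nonempty = *-cancelˡ-≤ (⁻¹-pos 0<x) (begin
      x ⁻¹ * exp (- (x ⁻¹))        ≤⟨ *-monoˡ-≤ (<⇒≤ (exp-pos _)) (≤-trans
                                        (transfer-≤ (<⇒≤ 0<1) (solve 1 (λ t → con (+ 1) :- con (+ 0) := (con (+ 1) :+ t) :- t) refl (x ⁻¹)))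
                                        (1+x≤exp (+-pos 0<1 (⁻¹-pos 0<x)))) ⟩
      exp (x ⁻¹) * exp (- (x ⁻¹))  ≈⟨ exp*exp-neg (x ⁻¹) ⟩
      1#                           ≈⟨ ⁻¹-inverse 0<x ⟨
      x * x ⁻¹                     ≈⟨ *-comm x _ ⟩
      x ⁻¹ * x                     ∎)

    bounded : UpperBound S x
    bounded y exp-y≤x = ≮⇒≥ λ x<y → ≤⇒≯ exp-y≤x (begin-strict
      x        <⟨ x<y ⟩
      y        ≤⟨ transfer-≤ (<⇒≤ 0<1) (solve 1 (λ t → con (+ 1) :- con (+ 0) := (con (+ 1) :+ t) :- t) refl y) ⟩
      1# + y   ≤⟨ 1+x≤exp (+-pos 0<1 (<-trans 0<x x<y)) ⟩
      exp y    ∎)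

    s-lub = lub S (_ , nonempty) (x , bounded)
    s = proj₁ s-lub

    exp-s≮x : ¬ exp s < x
    exp-s≮x p = ≤⇒≯ (proj₁ (proj₂ s-lub) (s + h) s+h∈S)
      (transfer-< 0<h (solve 2 (λ h s → h :- con (+ 0) := (s :+ h) :- s) refl h s))
      where
      r = exp s / x
      h = 1# - r
      0<r : 0# < r
      0<r = /-pos (exp-pos s) 0<x
      0<h : 0# < h
      0<h = x<y⇒0<y-x (*-cancelˡ-< (<⇒≤ 0<x) (<-resp-≈ (sym (/-cancel 0<x)) (sym (*-identityʳ x)) p))
      r≈1-h : r ≈ 1# + - h
      r≈1-h = solve 1 (λ r → r := con (+ 1) :+ (:- (con (+ 1) :- r))) refl r
      s+h∈S : S (s + h)
      s+h∈S = begin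
        exp (s + h)              ≈⟨ exp-+ s h ⟩
        exp s * exp h            ≈⟨ *-congʳ (/-cancel 0<x) ⟨
        x * r * exp h            ≈⟨ solve 3 (λ x r t → x :* r :* t := x :* (t :* r)) refl x r (exp h) ⟩
        x * (exp h * r)          ≤⟨ *-monoʳ-≤ (<⇒≤ 0<x) (*-monoʳ-≤ (<⇒≤ (exp-pos h))
                                      (≤-trans (≤-reflexive r≈1-h) (1+x≤exp (<-resp-≈ refl r≈1-h 0<r)))) ⟩
        x * (exp h * exp (- h))  ≈⟨ *-congˡ (exp*exp-neg h) ⟩
        x * 1#                   ≈⟨ *-identityʳ x ⟩
        x                        ∎

    x≮exp-s : ¬ x < exp s
    x≮exp-s p = ≤⇒≯ (proj₂ (proj₂ s-lub) (s - h) s-h-bound)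
      (transfer-< 0<h (solve 2 (λ h s → h :- con (+ 0) := s :- (s :- h)) refl h s))
      where
      r = x / exp s
      h = 1# - r
      0<r : 0# < r
      0<r = /-pos 0<x (exp-pos s)
      0<h : 0# < h
      0<h = x<y⇒0<y-x (*-cancelˡ-< (<⇒≤ (exp-pos s)) (<-resp-≈ (sym (/-cancel (exp-pos s))) (sym (*-identityʳ _)) p))
      r≈1-h : r ≈ 1# + - h
      r≈1-h = solve 1 (λ r → r := con (+ 1) :+ (:- (con (+ 1) :- r))) refl r
      x≤exp[s-h] : x ≤ exp (s - h)
      x≤exp[s-h] = begin
        x                   ≈⟨ /-cancel (exp-pos s) ⟨
        exp s * r           ≤⟨ *-monoʳ-≤ (<⇒≤ (exp-pos s)) (≤-trans (≤-reflexive r≈1-h) (1+x≤exp (<-resp-≈ refl r≈1-h 0<r))) ⟩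
        exp s * exp (- h)   ≈⟨ exp-+ s (- h) ⟨
        exp (s - h)         ∎
      s-h-bound : UpperBound S (s - h)
      s-h-bound y exp-y≤x = ≮⇒≥ λ s-h<y → ≤⇒≯ exp-y≤x (≤-<-trans x≤exp[s-h] (exp-mono-< s-h<y))

    exp-s≈x : exp s ≈ x
    exp-s≈x = ≤-antisym (≮⇒≥ x≮exp-s) (≮⇒≥ exp-s≮x)

  -- Surjectivity excludes the default branch of `log`. All further facts about `log` are obtained
  -- through this equation and the monotonicity of `exp`.
  exp-log : ∀ {x} → 0# < x → exp (log x) ≈ x
  exp-log {x} 0<x with em {∃[ y ] (exp y ≈ x)}
  ... | yes (_ , p) = p
  ... | no ¬p       = contradiction (exp-surjective 0<x) ¬p

  log-mono-< : ∀ {x y} → 0# < x → x < y → log x < log y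
  log-mono-< 0<x x<y = exp-cancel-< (<-resp-≈ (sym (exp-log 0<x)) (sym (exp-log (<-trans 0<x x<y))) x<y)

  0<log : ∀ {x} → 1# < x → 0# < log x
  0<log 1<x = exp-cancel-< (<-resp-≈ (sym exp-0) (sym (exp-log (<-trans 0<1 1<x))) 1<x)

  exp-·-log : ∀ {x} n → 0# < x → exp (fromℕ n * log x) ≈ x ^ n
  exp-·-log {x} zero    0<x = trans (exp-cong (zeroˡ _)) exp-0
  exp-·-log {x} (suc n) 0<x = begin-equality
    exp ((1# + fromℕ n) * log x)          ≈⟨ exp-cong (solve 2 (λ n l → (con (+ 1) :+ n) :* l := l :+ n :* l) refl (fromℕ n) (log x)) ⟩
    exp (log x + fromℕ n * log x)         ≈⟨ exp-+ _ _ ⟩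
    exp (log x) * exp (fromℕ n * log x)   ≈⟨ *-cong (exp-log 0<x) (exp-·-log n 0<x) ⟩
    x * x ^ n                             ∎

  P-pos : ∀ d → 0# < P d
  P-pos d = /-pos (0<log (transfer-< (/-pos 0<1 (fromℕ-pos {value d} (s≤s z≤n)))
      (solve 1 (λ t → t :- con (+ 0) := (con (+ 1) :+ t) :- con (+ 1)) refl (1# / fromℕ (value d)))))
    (0<log (<-resp-≈ fromℕ-1 refl (fromℕ-mono-< {1} {10} (s≤s (s≤s z≤n)))))

-- Positive density excludes proportional gaps.

module Density (em : ExcludedMiddle 0ℓ) (R : CompleteOrderedField) where

  open Benford em R
  open OrderedField em R
  open ≤-Reasoning
  open IntegerCoefficients commutativeRing

  -- The gaps are the windows [n, n + n/q].
  HasGaps : (ℕ → Set) → ℕ → Set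
  HasGaps A q = ∀ M → ∃[ n ] (M ℕ.≤ n × (∀ j → q ℕ.* j ℕ.≤ n → ¬ A (n ℕ.+ j)))

  count-suc : ∀ A N → ¬ A (suc N) → count A (suc N) ≡ count A N
  count-suc A N ¬a = ≡.trans (≡.cong (λ xs → length (filter A? xs)) (≡.sym (List.applyUpTo-∷ʳ suc N)))
    (≡.trans (≡.cong length (List.filter-++ A? (applyUpTo suc N) (suc N ∷ [])))
    (≡.trans (List.length-++ (filter A? (applyUpTo suc N)))
    (≡.trans (≡.cong (λ xs → count A N ℕ.+ length xs) (List.filter-reject A? ¬a)) (ℕ.+-identityʳ _))))
    where
    A? : ∀ n → Dec (A n)
    A? n = em {A n}

  count-gap : ∀ A n l → (∀ j → j ℕ.≤ l → ¬ A (n ℕ.+ j)) → count A (n ℕ.+ l) ≡ count A n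
  count-gap A n zero    ¬a = ≡.cong (count A) (ℕ.+-identityʳ n)
  count-gap A n (suc l) ¬a = ≡.trans (≡.cong (count A) (ℕ.+-suc n l))
    (≡.trans (count-suc A (n ℕ.+ l) (≡.subst (λ k → ¬ A k) (ℕ.+-suc n l) (¬a (suc l) ℕ.≤-refl)))
             (count-gap A n l (λ j j≤l → ¬a j (ℕ.m≤n⇒m≤1+n j≤l))))

  -- Rounding n/(q+1) down costs at most a factor 2: the quotient is at least 1, so the remainder is
  -- at most the divisor times the quotient.
  gap-length : ∀ n q → suc q ℕ.≤ n → n ℕ.≤ 2 ℕ.* suc q ℕ.* (n ℕ./ suc q)
  gap-length n q q<n = ℕ.≤-Reasoning.begin
    n                                  ℕ.≤-Reasoning.≡⟨ ℕ.m≡m%n+[m/n]*n n (suc q) ⟩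
    n ℕ.% suc q ℕ.+ l ℕ.* suc q        ℕ.≤-Reasoning.≤⟨ ℕ.+-monoˡ-≤ _ (ℕ.<⇒≤ (ℕ.m%n<n n (suc q))) ⟩
    suc q ℕ.+ l ℕ.* suc q              ℕ.≤-Reasoning.≤⟨ ℕ.+-monoˡ-≤ _ (ℕ.m≤n*m (suc q) l {{ℕ.>-nonZero (ℕ.m≥n⇒m/n>0 q<n)}}) ⟩
    l ℕ.* suc q ℕ.+ l ℕ.* suc q        ℕ.≤-Reasoning.≡⟨ rearrange l (suc q) ⟩
    2 ℕ.* suc q ℕ.* l                  ℕ.≤-Reasoning.∎
    where
    l = n ℕ./ suc q
    rearrange : ∀ l q → l ℕ.* q ℕ.+ l ℕ.* q ≡ 2 ℕ.* q ℕ.* l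
    rearrange = solve-∀

  -- The counts at the two ends of a window agree, while positive density
  -- would make them differ by a positive proportion.
  hasDensity⇒¬hasGaps : ∀ {A δ} q → 0# < δ → HasDensity A δ → ¬ HasGaps A (suc q)
  hasDensity⇒¬hasGaps {A} {δ} q 0<δ dens gaps = <-irrefl refl δ<δ
    where
    T = fromℕ (2 ℕ.* suc q)
    0≤T : 0# ≤ T
    0≤T = fromℕ-nonneg (2 ℕ.* suc q)
    0<T+T+1 : 0# < 1# + (T + T)
    0<T+T+1 = <-≤-trans 0<1 (transfer-≤ (+-nonneg 0≤T 0≤T) (solve 1 (λ t → (t :+ t) :- con (+ 0) := (con (+ 1) :+ (t :+ t)) :- con (+ 1)) refl T))
    -- The two estimates will give (1 + T)(δ - ε) < T (δ + ε), that is δ < (1 + 2T) ε; this ε turns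
    -- it into δ < δ.
    ε = δ / (1# + (T + T))
    0<ε : 0# < ε
    0<ε = /-pos 0<δ 0<T+T+1
    δ≈ : (1# + (T + T)) * ε ≈ δ
    δ≈ = /-cancel 0<T+T+1
    0≤δ-ε : 0# ≤ δ - ε
    0≤δ-ε = ≤-resp-≈ refl (trans (solve 2 (λ t e → (t :+ t) :* e := (con (+ 1) :+ (t :+ t)) :* e :- e) refl T ε) (+-congʳ δ≈))
      (*-nonneg (+-nonneg 0≤T 0≤T) (<⇒≤ 0<ε))
    N = proj₁ (dens ε 0<ε)
    close : ∀ n → N ℕ.≤ n → ∣ fromℕ (count A n) / fromℕ n - δ ∣ < ε
    close = proj₂ (dens ε 0<ε)
    -- `N` makes the density estimate valid at both ends of the window, and `suc q` makes the window
    -- long enough for `gap-length`.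
    gap = gaps (N ℕ.+ suc q)
    n = proj₁ gap
    q<n : suc q ℕ.≤ n
    q<n = ℕ.m+n≤o⇒n≤o N (proj₁ (proj₂ gap))
    N≤n : N ℕ.≤ n
    N≤n = ℕ.m+n≤o⇒m≤o N (proj₁ (proj₂ gap))
    l = n ℕ./ suc q
    0<n : 0# < fromℕ n
    0<n = fromℕ-pos {n} (ℕ.≤-trans (s≤s z≤n) q<n)
    0<n+l : 0# < fromℕ (n ℕ.+ l)
    0<n+l = <-≤-trans 0<n (fromℕ-mono-≤ (ℕ.m≤m+n n l))
    c = fromℕ (count A n)
    missed : ∀ j → j ℕ.≤ l → ¬ A (n ℕ.+ j)
    missed j j≤l = proj₂ (proj₂ gap) j (ℕ.≤-trans (ℕ.*-monoʳ-≤ (suc q) j≤l) (≡.subst (ℕ._≤ n) (ℕ.*-comm l (suc q)) (ℕ.m/n*n≤m n (suc q))))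
    c<n[δ+ε] : c < fromℕ n * (δ + ε)
    c<n[δ+ε] = /-<⇒ 0<n (transfer-< (proj₂ (∣x∣<y⇒-y<x×x<y _ (close n N≤n)))
      (solve 3 (λ x d e → e :- (x :- d) := (d :+ e) :- x) refl (c / fromℕ n) δ ε))
    [n+l][δ-ε]<c : fromℕ (n ℕ.+ l) * (δ - ε) < c
    [n+l][δ-ε]<c = <-resp-≈ refl (reflexive (≡.cong fromℕ (count-gap A n l missed)))
      (</⇒ 0<n+l (transfer-< (proj₁ (∣x∣<y⇒-y<x×x<y _ (close (n ℕ.+ l) (ℕ.≤-trans N≤n (ℕ.m≤m+n n l)))))
        (solve 3 (λ x d e → (x :- d) :- (:- e) := x :- (d :- e)) refl (fromℕ (count A (n ℕ.+ l)) / fromℕ (n ℕ.+ l)) δ ε)))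
    [1+T]n≤T[n+l] : (1# + T) * fromℕ n ≤ T * fromℕ (n ℕ.+ l)
    [1+T]n≤T[n+l] = begin
      (1# + T) * fromℕ n            ≈⟨ solve 2 (λ t n → (con (+ 1) :+ t) :* n := t :* n :+ n) refl T (fromℕ n) ⟩
      T * fromℕ n + fromℕ n         ≤⟨ +-mono-≤ ≤-refl (fromℕ-mono-≤ (gap-length n q q<n)) ⟩
      T * fromℕ n + fromℕ (2 ℕ.* suc q ℕ.* l) ≈⟨ +-congˡ (fromℕ-* (2 ℕ.* suc q) l) ⟩
      T * fromℕ n + T * fromℕ l     ≈⟨ distribˡ T _ _ ⟨
      T * (fromℕ n + fromℕ l)       ≈⟨ *-congˡ (fromℕ-+ n l) ⟨
      T * fromℕ (n ℕ.+ l)           ∎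
    [1+T][δ-ε]<T[δ+ε] : (1# + T) * (δ - ε) < T * (δ + ε)
    [1+T][δ-ε]<T[δ+ε] = *-cancelˡ-< (<⇒≤ 0<n) (begin-strict
      fromℕ n * ((1# + T) * (δ - ε))      ≈⟨ solve 3 (λ n s d → n :* (s :* d) := (s :* n) :* d) refl (fromℕ n) (1# + T) (δ - ε) ⟩
      (1# + T) * fromℕ n * (δ - ε)        ≤⟨ *-monoˡ-≤ 0≤δ-ε [1+T]n≤T[n+l] ⟩
      T * fromℕ (n ℕ.+ l) * (δ - ε)       ≈⟨ *-assoc _ _ _ ⟩
      T * (fromℕ (n ℕ.+ l) * (δ - ε))     <⟨ *-monoʳ-< (fromℕ-pos {2 ℕ.* suc q} (s≤s z≤n)) (<-trans [n+l][δ-ε]<c c<n[δ+ε]) ⟩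
      T * (fromℕ n * (δ + ε))             ≈⟨ solve 3 (λ n s d → s :* (n :* d) := n :* (s :* d)) refl (fromℕ n) T (δ + ε) ⟩
      fromℕ n * (T * (δ + ε))             ∎)
    δ<δ : δ < δ
    δ<δ = <-resp-≈ refl δ≈ (transfer-< [1+T][δ-ε]<T[δ+ε]
      (solve 3 (λ t d e → t :* (d :+ e) :- (con (+ 1) :+ t) :* (d :- e) := (con (+ 1) :+ (t :+ t)) :* e :- d) refl T δ ε))

-- Windows on which the growth ratio is nearly constant.

module Growth (em : ExcludedMiddle 0ℓ) (R : CompleteOrderedField)
  (a : ℕ → CompleteOrderedField.Carrier R)
  (a-pos : ∀ n → 1 ℕ.≤ n → CompleteOrderedField._<_ R (CompleteOrderedField.0# R) (a n)) where

  open Benford em R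
  open OrderedField em R
  open Exponential em R
  open ≤-Reasoning
  open IntegerCoefficients commutativeRing

  Δ : ℕ → ℝ
  Δ = Δlog a

  exp-Δ : ∀ n → 1 ℕ.≤ n → exp (Δ n) * a n ≈ a (suc n)
  exp-Δ n 1≤n = begin-equality
    exp (Δ n) * a n              ≈⟨ *-congˡ (exp-log (a-pos n 1≤n)) ⟨
    exp (Δ n) * exp (log (a n))  ≈⟨ exp-+ _ _ ⟨
    exp (Δ n + log (a n))        ≈⟨ exp-cong (solve 2 (λ x y → (x :- y) :+ y := x) refl (log (a (suc n))) (log (a n))) ⟩
    exp (log (a (suc n)))        ≈⟨ exp-log (a-pos (suc n) (s≤s z≤n)) ⟩
    a (suc n)                    ∎

  exp[log+·log] : ∀ {x y} k → 0# < x → 0# < y → exp (log x + fromℕ k * log y) ≈ x * y ^ k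
  exp[log+·log] k 0<x 0<y = trans (exp-+ _ _) (*-cong (exp-log 0<x) (exp-·-log k 0<y))

  module _ {x y : ℝ} (k n : ℕ) (1≤n : 1 ℕ.≤ n) (0<x : 0# < x) (0<y : 0# < y) where

    growth-≥ : log x + fromℕ k * log y ≤ Δ n → x * y ^ k * a n ≤ a (suc n)
    growth-≥ p = ≤-resp-≈ (*-congʳ (exp[log+·log] k 0<x 0<y)) (exp-Δ n 1≤n)
      (*-monoˡ-≤ (<⇒≤ (a-pos n 1≤n)) (exp-mono-≤ p))

    growth-≤ : Δ n ≤ log x + fromℕ k * log y → a (suc n) ≤ x * y ^ k * a n
    growth-≤ p = ≤-resp-≈ (exp-Δ n 1≤n) (*-congʳ (exp[log+·log] k 0<x 0<y))
      (*-monoˡ-≤ (<⇒≤ (a-pos n 1≤n)) (exp-mono-≤ p))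

  -- A discrete intermediate value argument: the recursion runs over the distance `k` to an index
  -- where `t` is known to be reached, and stops at the first passage.
  crossing : ∀ (s : ℕ → ℝ) t k M → s M < t → t ≤ s (M ℕ.+ k) → ∃[ n ] (M ℕ.≤ n × s n < t × t ≤ s (suc n))
  crossing s t zero    M p q = contradiction p (≤⇒≯ (≤-trans q (≤-reflexive (reflexive (≡.cong s (ℕ.+-identityʳ M))))))
  crossing s t (suc k) M p q with <-or-≥ (s (suc M)) t
  ... | inj₂ t≤s = M , ℕ.≤-refl , p , t≤s
  ... | inj₁ s<t with crossing s t k (suc M) s<t (≤-trans q (≤-reflexive (reflexive (≡.cong s (ℕ.+-suc M k)))))
  ...   | n , M<n , r = n , ℕ.<⇒≤ M<n , r

  ⁻¹-anti-≤ : ∀ {x y} → 0# < x → x ≤ y → y ⁻¹ ≤ x ⁻¹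
  ⁻¹-anti-≤ {x} {y} 0<x x≤y = *≤1⇒≤⁻¹ 0<x (begin
    y ⁻¹ * x  ≤⟨ *-monoʳ-≤ (<⇒≤ (⁻¹-pos 0<y)) x≤y ⟩
    y ⁻¹ * y  ≈⟨ *-comm _ _ ⟩
    y * y ⁻¹  ≈⟨ ⁻¹-inverse 0<y ⟩
    1#        ∎)
    where
    0<y : 0# < y
    0<y = <-≤-trans 0<x x≤y

  module _ (Δ→∞ : Δ ⟶∞) (ΔΔ=O : (λ n → Δ (suc n) - Δ n) =O (λ n → 1# / fromℕ n)) where

    private
      C = proj₁ ΔΔ=O
      -- A natural number above the O-constant is nonnegative, as the monotonicity steps require.
      κ = fromℕ (proj₁ (archimedean C))
      C<κ : C < κ
      C<κ = proj₂ (archimedean C)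
      0≤κ : 0# ≤ κ
      0≤κ = fromℕ-nonneg (proj₁ (archimedean C))
      N : ℕ
      -- The successor keeps every n ≥ N positive, away from the unspecified inverse of 0.
      N = suc (proj₁ (proj₂ ΔΔ=O))
      1≤ : ∀ {n} → N ℕ.≤ n → 1 ℕ.≤ n
      1≤ = ℕ.≤-trans (s≤s z≤n)

    Δ-step : ∀ n → N ℕ.≤ n → ∣ Δ (suc n) - Δ n ∣ ≤ κ / fromℕ n
    Δ-step n N≤n = begin
      ∣ Δ (suc n) - Δ n ∣   ≤⟨ proj₂ (proj₂ ΔΔ=O) n (ℕ.<⇒≤ N≤n) ⟩
      C * ∣ 1# / fromℕ n ∣  ≈⟨ *-congˡ (trans (∣pos∣ (/-pos 0<1 0<n)) (*-identityˡ _)) ⟩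
      C * fromℕ n ⁻¹        ≤⟨ *-monoˡ-≤ (<⇒≤ (⁻¹-pos 0<n)) (<⇒≤ C<κ) ⟩
      κ / fromℕ n           ∎
      where
      0<n : 0# < fromℕ n
      0<n = fromℕ-pos {n} (1≤ N≤n)

    -- Each of the j steps is bounded by κ/(n + i) ≤ κ/n.
    Δ-drift : ∀ n → N ℕ.≤ n → ∀ j →
              Δ n - fromℕ j * (κ / fromℕ n) ≤ Δ (n ℕ.+ j) × Δ (n ℕ.+ j) ≤ Δ n + fromℕ j * (κ / fromℕ n)
    Δ-drift n N≤n zero    rewrite ℕ.+-identityʳ n =
        ≤-reflexive (solve 2 (λ d k → d :- con (+ 0) :* k := d) refl (Δ n) (κ / fromℕ n))
      , ≤-reflexive (solve 2 (λ d k → d := d :+ con (+ 0) :* k) refl (Δ n) (κ / fromℕ n))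
    Δ-drift n N≤n (suc j) rewrite ℕ.+-suc n j =
        transfer-≤ (+-mono-≤ (proj₁ (Δ-drift n N≤n j)) (≤-trans (-x≤∣x∣ _) step))
          (solve 5 (λ d e f j k → (e :+ k) :- ((d :- j :* k) :+ (:- (f :- e))) := f :- (d :- (con (+ 1) :+ j) :* k))
            refl (Δ n) (Δ (n ℕ.+ j)) (Δ (suc (n ℕ.+ j))) (fromℕ j) (κ / fromℕ n))
      , transfer-≤ (+-mono-≤ (proj₂ (Δ-drift n N≤n j)) (≤-trans (x≤∣x∣ _) step))
          (solve 5 (λ d e f j k → (d :+ j :* k :+ k) :- (e :+ (f :- e)) := (d :+ (con (+ 1) :+ j) :* k) :- f)
            refl (Δ n) (Δ (n ℕ.+ j)) (Δ (suc (n ℕ.+ j))) (fromℕ j) (κ / fromℕ n))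
      where
      step : ∣ Δ (suc (n ℕ.+ j)) - Δ (n ℕ.+ j) ∣ ≤ κ / fromℕ n
      step = ≤-trans (Δ-step (n ℕ.+ j) (ℕ.≤-trans N≤n (ℕ.m≤m+n n j)))
        (*-monoʳ-≤ 0≤κ (⁻¹-anti-≤ (fromℕ-pos {n} (1≤ N≤n)) (fromℕ-mono-≤ (ℕ.m≤m+n n j))))

    -- Δ enters the interval [log x + k log y, log z + k log y] for suitable k,
    -- and stays there for a time proportional to n.
    slow-windows : ∀ {x y z} → 1# < x → 1# < y → x < z →
      ∃[ q ] (∀ M → ∃[ n ] (M ℕ.≤ n × ∃[ k ] (∀ j → suc q ℕ.* j ℕ.≤ n →
        x * y ^ k * a (n ℕ.+ j) ≤ a (suc (n ℕ.+ j)) × a (suc (n ℕ.+ j)) ≤ z * y ^ k * a (n ℕ.+ j))))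
    slow-windows {x} {y} {z} 1<x 1<y x<z = q , windows
      where
      0<x = <-trans 0<1 1<x
      0<y = <-trans 0<1 1<y
      0<z = <-trans 0<x x<z
      L = log y
      0<L : 0# < L
      0<L = 0<log 1<y
      -- `g` is a quarter of log z - log x, and the target `t` is the midpoint of the interval.
      -- Above `t`, one `g` pays for the overshoot at the crossing and one for the drift during the
      -- window.
      h-half = half (x<y⇒0<y-x (log-mono-< 0<x x<z))
      h = proj₁ h-half
      g-half = half (proj₁ (proj₂ h-half))
      g = proj₁ g-half
      0<g : 0# < g
      0<g = proj₁ (proj₂ g-half)
      log-z≈ : log x + (g + g) + (g + g) ≈ log z
      log-z≈ = trans (+-cong (+-congˡ (proj₂ (proj₂ g-half))) (proj₂ (proj₂ g-half)))
        (trans (+-assoc _ _ _) (trans (+-congˡ (proj₂ (proj₂ h-half)))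
          (solve 2 (λ x z → x :+ (z :- x) := z) refl (log x) (log z))))
      -- With q ≥ κ/g, at most n/q steps of size κ/n drift by at most `g`.
      q = proj₁ (archimedean (κ / g))
      κ≤q*g : κ ≤ fromℕ q * g
      κ≤q*g = ≤-resp-≈ refl (*-comm g _) (<⇒≤ (/-<⇒ 0<g (proj₂ (archimedean (κ / g)))))
      windows : ∀ M → ∃[ n ] (M ℕ.≤ n × ∃[ k ] (∀ j → suc q ℕ.* j ℕ.≤ n →
        x * y ^ k * a (n ℕ.+ j) ≤ a (suc (n ℕ.+ j)) × a (suc (n ℕ.+ j)) ≤ z * y ^ k * a (n ℕ.+ j)))
      windows M = suc n , ℕ.≤-trans (ℕ.≤-trans (ℕ.m≤m+n M _) M′≤n) (ℕ.n≤1+n n) , k , λ j qj≤n →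
          growth-≥ k (suc n ℕ.+ j) (s≤s z≤n) 0<x 0<y (begin
            log x + fromℕ k * L       ≤⟨ transfer-≤ (<⇒≤ 0<g) (solve 3 (λ l g b → g :- con (+ 0) := (l :+ (g :+ g) :+ b :- g) :- (l :+ b)) refl (log x) g (fromℕ k * L)) ⟩
            t - g                     ≤⟨ +-mono-≤ t≤Δ (neg-mono-≤ (drift≤g j qj≤n)) ⟩
            Δ (suc n) - fromℕ j * (κ / fromℕ (suc n)) ≤⟨ proj₁ (Δ-drift (suc n) N≤1+n j) ⟩
            Δ (suc n ℕ.+ j)           ∎)
        , growth-≤ k (suc n ℕ.+ j) (s≤s z≤n) 0<z 0<y (begin
            Δ (suc n ℕ.+ j)           ≤⟨ proj₂ (Δ-drift (suc n) N≤1+n j) ⟩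
            Δ (suc n) + fromℕ j * (κ / fromℕ (suc n)) ≤⟨ +-mono-≤ Δ≤t+g (drift≤g j qj≤n) ⟩
            t + g + g                 ≈⟨ solve 3 (λ l g b → l :+ (g :+ g) :+ b :+ g :+ g := (l :+ (g :+ g) :+ (g :+ g)) :+ b) refl (log x) g (fromℕ k * L) ⟩
            log x + (g + g) + (g + g) + fromℕ k * L ≈⟨ +-congʳ log-z≈ ⟩
            log z + fromℕ k * L       ∎)
        where
        -- Including `q` bounds the single crossing step too: q ≤ n gives κ/n ≤ g.
        M′ = M ℕ.+ (N ℕ.+ q)
        -- So many multiples of log y put the target above `Δ M′`, so that it is crossed only after
        -- `M′`.
        k = proj₁ (archimedean (Δ M′ / L))
        t = log x + (g + g) + fromℕ k * L
        ΔM′<t : Δ M′ < t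
        ΔM′<t = begin-strict
          Δ M′          <⟨ /-<⇒ 0<L (proj₂ (archimedean (Δ M′ / L))) ⟩
          L * fromℕ k   ≈⟨ *-comm L _ ⟩
          fromℕ k * L   ≤⟨ transfer-≤ (<⇒≤ (+-pos (0<log 1<x) (+-pos 0<g 0<g))) (solve 2 (λ c b → c :- con (+ 0) := (c :+ b) :- b) refl (log x + (g + g)) (fromℕ k * L)) ⟩
          t             ∎
        late = Δ→∞ t
        cross = crossing Δ t (proj₁ late) M′ ΔM′<t (<⇒≤ (proj₂ late (M′ ℕ.+ proj₁ late) (ℕ.m≤n+m (proj₁ late) M′)))
        n = proj₁ cross
        M′≤n : M′ ℕ.≤ n
        M′≤n = proj₁ (proj₂ cross)
        N+q≤n : N ℕ.+ q ℕ.≤ n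
        N+q≤n = ℕ.m+n≤o⇒n≤o M M′≤n
        N≤n : N ℕ.≤ n
        N≤n = ℕ.m+n≤o⇒m≤o N N+q≤n
        N≤1+n : N ℕ.≤ suc n
        N≤1+n = ℕ.m≤n⇒m≤1+n N≤n
        t≤Δ : t ≤ Δ (suc n)
        t≤Δ = proj₂ (proj₂ (proj₂ cross))
        multiple≤g : ∀ m j → 1 ℕ.≤ m → q ℕ.* j ℕ.≤ m → fromℕ j * (κ / fromℕ m) ≤ g
        multiple≤g m j 1≤m qj≤m = *-cancelˡ-≤ 0<m (begin
          fromℕ m * (fromℕ j * (κ / fromℕ m))  ≈⟨ solve 3 (λ m j k → m :* (j :* k) := j :* (m :* k)) refl (fromℕ m) (fromℕ j) (κ / fromℕ m) ⟩
          fromℕ j * (fromℕ m * (κ / fromℕ m))  ≈⟨ *-congˡ (/-cancel 0<m) ⟩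
          fromℕ j * κ                          ≤⟨ *-monoʳ-≤ (fromℕ-nonneg j) κ≤q*g ⟩
          fromℕ j * (fromℕ q * g)              ≈⟨ solve 3 (λ j q g → j :* (q :* g) := (q :* j) :* g) refl (fromℕ j) (fromℕ q) g ⟩
          fromℕ q * fromℕ j * g                ≈⟨ *-congʳ (fromℕ-* q j) ⟨
          fromℕ (q ℕ.* j) * g                  ≤⟨ *-monoˡ-≤ (<⇒≤ 0<g) (fromℕ-mono-≤ qj≤m) ⟩
          fromℕ m * g                          ∎)
          where
          0<m : 0# < fromℕ m
          0<m = fromℕ-pos {m} 1≤m
        drift≤g : ∀ j → suc q ℕ.* j ℕ.≤ suc n → fromℕ j * (κ / fromℕ (suc n)) ≤ g
        drift≤g j p = multiple≤g (suc n) j (s≤s z≤n) (ℕ.m+n≤o⇒n≤o j p)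
        Δ≤t+g : Δ (suc n) ≤ t + g
        Δ≤t+g = begin
          Δ (suc n)                     ≈⟨ solve 2 (λ d e → e := d :+ (e :- d)) refl (Δ n) (Δ (suc n)) ⟩
          Δ n + (Δ (suc n) - Δ n)       ≤⟨ +-mono-≤ (<⇒≤ (proj₁ (proj₂ (proj₂ cross)))) (≤-trans (x≤∣x∣ _) (Δ-step n N≤n)) ⟩
          t + κ / fromℕ n               ≈⟨ +-congˡ (trans (sym (*-identityˡ _)) (*-congʳ (sym fromℕ-1))) ⟩
          t + fromℕ 1 * (κ / fromℕ n)   ≤⟨ +-mono-≤ ≤-refl (multiple≤g n 1 (1≤ N≤n) (≡.subst (ℕ._≤ n) (≡.sym (ℕ.*-identityʳ q)) (ℕ.m+n≤o⇒n≤o N N+q≤n))) ⟩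
          t + g                         ∎

-- Leading digits under multiplication by 2 to 2.1.

module LeadingDigits (em : ExcludedMiddle 0ℓ) (R : CompleteOrderedField) where

  open Benford em R hiding (zero)
  open OrderedField em R
  open ≤-Reasoning
  open IntegerCoefficients commutativeRing

  one : Digit
  one = Fin.zero

  private
    t = fromℕ 10

    0<t : 0# < t
    0<t = fromℕ-pos {10} (s≤s z≤n)

    1≤t : 1# ≤ t
    1≤t = ≤-resp-≈ fromℕ-1 refl (fromℕ-mono-≤ {1} {10} (s≤s z≤n))

  ^ℤ-pos : ∀ {x} k → 0# < x → 0# < x ^ℤ k
  ^ℤ-pos (+ n)    0<x = ^-pos n 0<x
  ^ℤ-pos -[1+ n ] 0<x = ⁻¹-pos (^-pos (suc n) 0<x)

  ^ℤ-suc : ∀ {x} k → 0# < x → x ^ℤ (ℤ.suc k) ≈ x * x ^ℤ k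
  ^ℤ-suc (+ n)              0<x = refl
  ^ℤ-suc {x} -[1+ zero ]    0<x = sym (*-cancelˡ-≈ (^-pos 1 0<x) (begin-equality
    x ^ 1 * (x * (x ^ 1) ⁻¹)  ≈⟨ /-cancel (^-pos 1 0<x) ⟩
    x                         ≈⟨ solve 1 (λ x → x := x :* con (+ 1) :* con (+ 1)) refl x ⟩
    x ^ 1 * 1#                ∎))
  ^ℤ-suc {x} -[1+ suc n ]   0<x = ⁻¹-unique (^-pos (suc n) 0<x) (begin-equality
    x ^ suc n * (x * i)       ≈⟨ solve 3 (λ x p i → p :* (x :* i) := (x :* p) :* i) refl x (x ^ suc n) i ⟩
    x ^ suc (suc n) * i       ≈⟨ ⁻¹-inverse (^-pos (suc (suc n)) 0<x) ⟩
    1#                        ∎)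
    where
    i = (x ^ suc (suc n)) ⁻¹

  ^ℤ-+ : ∀ {x} k n → 0# < x → x ^ℤ (k ℤ.+ (+ n)) ≈ x ^ n * x ^ℤ k
  ^ℤ-+ {x} k zero    0<x = trans (reflexive (≡.cong (x ^ℤ_) (ℤ.+-identityʳ k))) (sym (*-identityˡ _))
  ^ℤ-+ {x} k (suc n) 0<x = begin-equality
    x ^ℤ (k ℤ.+ (+ suc n))      ≡⟨ ≡.cong (x ^ℤ_) (≡.trans (≡.sym (ℤ.+-assoc k (+ 1) (+ n))) (≡.trans (≡.cong (λ i → i ℤ.+ (+ n)) (ℤ.+-comm k (+ 1))) (ℤ.+-assoc (+ 1) k (+ n)))) ⟩
    x ^ℤ (ℤ.suc (k ℤ.+ (+ n)))  ≈⟨ ^ℤ-suc (k ℤ.+ (+ n)) 0<x ⟩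
    x * x ^ℤ (k ℤ.+ (+ n))      ≈⟨ *-congˡ (^ℤ-+ k n 0<x) ⟩
    x * (x ^ n * x ^ℤ k)        ≈⟨ *-assoc _ _ _ ⟨
    x ^ suc n * x ^ℤ k          ∎

  1≤^ : ∀ {x} n → 1# ≤ x → 1# ≤ x ^ n
  1≤^ n 1≤x = ≤-trans (≤-reflexive (sym (1^n≈1 n))) (^-monoˡ-≤ n (<⇒≤ 0<1) 1≤x)

  ^ℤ-mono-≤ : ∀ {x j k} → 1# ≤ x → j ℤ.≤ k → x ^ℤ j ≤ x ^ℤ k
  ^ℤ-mono-≤ {x} {j} {k} 1≤x j≤k = begin
    x ^ℤ j                       ≈⟨ *-identityˡ _ ⟨
    1# * x ^ℤ j                  ≤⟨ *-monoˡ-≤ (<⇒≤ (^ℤ-pos j 0<x)) (1≤^ n 1≤x) ⟩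
    x ^ n * x ^ℤ j               ≈⟨ ^ℤ-+ j n 0<x ⟨
    x ^ℤ (j ℤ.+ (+ n))           ≡⟨ ≡.cong (x ^ℤ_) j+n≡k ⟩
    x ^ℤ k                       ∎
    where
    0<x : 0# < x
    0<x = <-≤-trans 0<1 1≤x
    n = ℤ.∣ k ℤ.- j ∣
    j+n≡k : j ℤ.+ (+ n) ≡ k
    j+n≡k = ≡.trans (≡.cong (λ i → j ℤ.+ i) (ℤ.0≤i⇒+∣i∣≡i (ℤ.i≤j⇒0≤j-i j≤k)))
      (≡.trans (ℤ.+-comm j _) (≡.trans (ℤ.+-assoc k (ℤ.- j) j) (≡.trans (≡.cong (λ i → k ℤ.+ i) (ℤ.+-inverseˡ j)) (ℤ.+-identityʳ k))))

  ^ℤ-cancel-< : ∀ {x j k} → 1# ≤ x → x ^ℤ j < x ^ℤ k → j ℤ.< k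
  ^ℤ-cancel-< {x} {j} {k} 1≤x p = ℤ.≰⇒> λ k≤j → ≤⇒≯ (^ℤ-mono-≤ 1≤x k≤j) p

  fromℕ-*-10^ℤ : ∀ n k → fromℕ (n ℕ.* 10) * t ^ℤ k ≈ fromℕ n * t ^ℤ (ℤ.suc k)
  fromℕ-*-10^ℤ n k = trans (*-congʳ (fromℕ-* n 10)) (trans (*-assoc (fromℕ n) t (t ^ℤ k)) (*-congˡ (sym (^ℤ-suc k 0<t))))

  fromℕ-*-mono-≤ : ∀ {m n} k → m ℕ.≤ n → fromℕ m * t ^ℤ k ≤ fromℕ n * t ^ℤ k
  fromℕ-*-mono-≤ k m≤n = *-monoˡ-≤ (<⇒≤ (^ℤ-pos k 0<t)) (fromℕ-mono-≤ m≤n)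

  -- For numerals the implicit argument has the unit type and is inferred, so the inequality is
  -- checked by evaluation.
  ≤! : ∀ {m n} {_ : Bool.T (m ℕ.≤ᵇ n)} → m ℕ.≤ n
  ≤! {m} {n} {p} = ℕ.≤ᵇ⇒≤ m n p

  -- Because the exponent is free, decimal bounds such as 2 and 2.1 can be written 20 and 21.
  -- Interval arithmetic thus stays within ℕ.
  record Between (x : ℝ) (lo hi : ℕ) : Set where
    constructor between
    field
      exponent : ℤ
      lower    : fromℕ lo * t ^ℤ exponent ≤ x
      upper    : x < fromℕ hi * t ^ℤ exponent

  between⇒digit : ∀ {x} → Between x 1 2 → D[ x ]= one
  between⇒digit (between k u v) = k , u , v

  digit⇒between : ∀ {x} → D[ x ]= one → Between x 1 2
  digit⇒between (k , u , v) = between k u v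

  module _ {x : ℝ} where

    widen : ∀ {lo hi} lo′ hi′ → lo′ ℕ.≤ lo → hi ℕ.≤ hi′ → Between x lo hi → Between x lo′ hi′
    widen lo′ hi′ p q (between k u v) = between k
      (≤-trans (fromℕ-*-mono-≤ k p) u)
      (<-≤-trans v (fromℕ-*-mono-≤ k q))

    split : ∀ {lo hi} m → Between x lo hi → Between x lo m ⊎ Between x m hi
    split m (between k u v) with <-or-≥ x (fromℕ m * t ^ℤ k)
    ... | inj₁ p = inj₁ (between k u p)
    ... | inj₂ p = inj₂ (between k p v)

    shift : ∀ lo hi → Between x (lo ℕ.* 10) (hi ℕ.* 10) → Between x lo hi
    shift lo hi (between k u v) = between (ℤ.suc k) (≤-resp-≈ (fromℕ-*-10^ℤ lo k) refl u) (<-resp-≈ refl (fromℕ-*-10^ℤ hi k) v)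

  fromℕ≤10^ : ∀ n → fromℕ n ≤ t ^ n
  fromℕ≤10^ zero    = <⇒≤ 0<1
  fromℕ≤10^ (suc n) = begin
    1# + fromℕ n      ≤⟨ +-mono-≤ (1≤^ n 1≤t) (fromℕ≤10^ n) ⟩
    t ^ n + t ^ n     ≈⟨ solve 1 (λ p → p :+ p := (con (+ 1) :+ (con (+ 1) :+ con (+ 0))) :* p) refl (t ^ n) ⟩
    fromℕ 2 * t ^ n   ≤⟨ *-monoˡ-≤ (^-nonneg n (<⇒≤ 0<t)) (fromℕ-mono-≤ {2} {10} (s≤s (s≤s z≤n))) ⟩
    t * t ^ n         ∎

  -- Existence of a leading digit: from a power of 10 below x, the exponent is raised until the next
  -- power exceeds x; `m` bounds the number of steps.
  between-1-10 : ∀ {x} → 0# < x → Between x 1 10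
  between-1-10 {x} 0<x = climb -[1+ n ] m low (<-≤-trans (/-<⇒ 0<z (proj₂ (archimedean (x / z))))
      (≤-trans (*-monoʳ-≤ (<⇒≤ 0<z) (fromℕ≤10^ m)) (≤-reflexive (*-comm _ _))))
    where
    climb : ∀ k m → t ^ℤ k ≤ x → x < t ^ m * t ^ℤ k → Between x 1 10
    climb k zero    p q = contradiction (<-resp-≈ refl (*-identityˡ _) q) (≤⇒≯ p)
    climb k (suc m) p q with <-or-≥ x (t * t ^ℤ k)
    ... | inj₁ r = between k (≤-trans (≤-reflexive (trans (*-congʳ fromℕ-1) (*-identityˡ _))) p) r
    ... | inj₂ r = climb (ℤ.suc k) m (≤-trans (≤-reflexive (^ℤ-suc k 0<t)) r)
      (<-≤-trans q (≤-reflexive (trans (solve 3 (λ t p z → t :* p :* z := p :* (t :* z)) refl t (t ^ m) (t ^ℤ k))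
                                       (*-congˡ (sym (^ℤ-suc k 0<t))))))
    n = proj₁ (archimedean (1# / x))
    z = t ^ℤ -[1+ n ]
    0<z : 0# < z
    0<z = ^ℤ-pos -[1+ n ] 0<t
    m = proj₁ (archimedean (x / z))
    low : z ≤ x
    low = *-cancelˡ-≤ (^-pos (suc n) 0<t) (begin
      t ^ suc n * z        ≈⟨ ⁻¹-inverse (^-pos (suc n) 0<t) ⟩
      1#                   ≤⟨ <⇒≤ (/-<⇒ 0<x (proj₂ (archimedean (1# / x)))) ⟩
      x * fromℕ n          ≤⟨ *-monoʳ-≤ (<⇒≤ 0<x) (≤-trans (fromℕ-mono-≤ (ℕ.n≤1+n n)) (fromℕ≤10^ (suc n))) ⟩
      x * t ^ suc n        ≈⟨ *-comm _ _ ⟩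
      t ^ suc n * x        ∎)

  -- Up to a power of 10, y lies between 2 x and 2.1 x; the bounds are scaled
  -- by 10 to be natural numbers.
  Doubles : ℝ → ℝ → Set
  Doubles x y = ∃[ k ] (fromℕ 20 * t ^ k * x ≤ y × y ≤ fromℕ 21 * t ^ k * x)

  between-step : ∀ {x y lo hi} → Doubles x y → Between x lo hi → Between y (20 ℕ.* lo) (21 ℕ.* hi)
  between-step {x} {y} {lo} {hi} (m , p , q) (between k u v) = between (k ℤ.+ (+ m))
    (≤-trans (≤-reflexive (move 20 lo)) (≤-trans (*-monoʳ-≤ (<⇒≤ (0<c 20 (s≤s z≤n))) u) p))
    (≤-<-trans q (<-≤-trans (*-monoʳ-< (0<c 21 (s≤s z≤n)) v) (≤-reflexive (sym (move 21 hi)))))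
    where
    0<c : ∀ c → 1 ℕ.≤ c → 0# < fromℕ c * t ^ m
    0<c c 1≤c = *-pos (fromℕ-pos {c} 1≤c) (^-pos m 0<t)
    move : ∀ c l → fromℕ (c ℕ.* l) * t ^ℤ (k ℤ.+ (+ m)) ≈ fromℕ c * t ^ m * (fromℕ l * t ^ℤ k)
    move c l = trans (*-cong (fromℕ-* c l) (^ℤ-+ k m 0<t))
      (solve 4 (λ c l p z → c :* l :* (p :* z) := c :* p :* (l :* z)) refl (fromℕ c) (fromℕ l) (t ^ m) (t ^ℤ k))

  -- The ranges [m, 10 n) and [n, m) are complementary up to powers of 10: a common element would
  -- force the exponent l strictly between k + 1 and k + 2.
  between-disjoint : ∀ m n {x} → Between x (m ℕ.* 10) (n ℕ.* 10 ℕ.* 10) → ¬ Between x n m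
  between-disjoint m n {x} (between k p q) (between l u v) = ℤ.<⇒≱ l<2+k (ℤ.i<j⇒suc[i]≤j 1+k<l)
    where
    1+k<l : ℤ.suc k ℤ.< l
    1+k<l = ^ℤ-cancel-< 1≤t (*-cancelˡ-< (fromℕ-nonneg m)
      (≤-<-trans (≤-resp-≈ (fromℕ-*-10^ℤ m k) refl p) v))
    l<2+k : l ℤ.< ℤ.suc (ℤ.suc k)
    l<2+k = ^ℤ-cancel-< 1≤t (*-cancelˡ-< (fromℕ-nonneg n)
      (≤-<-trans u (<-≤-trans q
        (≤-reflexive (trans (fromℕ-*-10^ℤ (n ℕ.* 10) k) (fromℕ-*-10^ℤ n (ℤ.suc k)))))))

  -- From [1, 2) the next term lands in [2, 4.2), which lies in the complementary range [2, 10).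
  ¬1-twice : ∀ {x y} → Doubles x y → D[ x ]= one → ¬ D[ y ]= one
  ¬1-twice d dx dy = between-disjoint 2 1
    (widen 20 100 ≤! ≤! (between-step d (digit⇒between dx))) (digit⇒between dy)

  module _ (b : ℕ → ℝ) (0<b : 0# < b 0) (doubles : ∀ j → j ℕ.< 6 → Doubles (b j) (b (suc j))) where

    private
      Visit : Set
      Visit = ∃[ j ] (j ℕ.≤ 6 × D[ b j ]= one)

      next : ∀ j {lo hi} → j ℕ.≤ 5 → Between (b j) lo hi → Between (b (suc j)) (20 ℕ.* lo) (21 ℕ.* hi)
      next j j≤5 = between-step (doubles j (s≤s j≤5))

      -- One step leads to [10, 21). The part [20, 21) that misses digit 1 continues, with upper
      -- ends rounded up, to [40, 45), [80, 95) and [160, 199.5). This takes four steps, hence i ≤ 2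
      -- for a total of six.
      from-5-10 : ∀ i → i ℕ.≤ 2 → Between (b i) 5 10 → Visit
      from-5-10 i i≤2 p = [ near , far ]′ (split 20 (shift 10 21 (next i (ℕ.≤-trans i≤2 ≤!) p)))
        where
        near : Between (b (1 ℕ.+ i)) 10 20 → Visit
        near q = 1 ℕ.+ i , ℕ.+-mono-≤ {1} {4} ≤! i≤2 , between⇒digit (shift 1 2 q)
        far : Between (b (1 ℕ.+ i)) 20 21 → Visit
        far q₁ = 4 ℕ.+ i , ℕ.+-monoʳ-≤ 4 i≤2 ,
            between⇒digit (shift 1 2 (shift 10 20 (shift 100 200 (widen 1000 2000 ≤! ≤! q₄))))
          where
          q₂ : Between (b (2 ℕ.+ i)) 40 45
          q₂ = shift 40 45 (widen 400 450 ≤! ≤! (next (1 ℕ.+ i) (ℕ.+-mono-≤ {1} {3} ≤! i≤2) q₁))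
          q₃ : Between (b (3 ℕ.+ i)) 80 95
          q₃ = shift 80 95 (widen 800 950 ≤! ≤! (next (2 ℕ.+ i) (ℕ.+-mono-≤ {2} {3} ≤! i≤2) q₂))
          q₄ : Between (b (4 ℕ.+ i)) 1600 1995
          q₄ = next (3 ℕ.+ i) (ℕ.+-mono-≤ {3} {3} ≤! i≤2) q₃

      -- The image of [2, 5) is within [4, 10.5), and that of [4, 5) within [8, 10.5). So after at
      -- most two steps the term either has digit 1 or lies in [5, 10).
      from-2-5 : Between (b 0) 2 5 → Visit
      from-2-5 p = [ below-100 , from-100 ]′ (split 100 (next 0 z≤n p))
        where
        from-100 : Between (b 1) 100 105 → Visit
        from-100 q = 1 , ≤! , between⇒digit (shift 1 2 (shift 10 20 (widen 100 200 ≤! ≤! q)))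
        below-50 : Between (b 1) 40 50 → Visit
        below-50 q =
          [ (λ r → from-5-10 2 ≤! (shift 5 10 (shift 50 100 (widen 500 1000 ≤! ≤! r))))
          , (λ r → 2 , ≤! , between⇒digit (shift 1 2 (shift 10 20 (shift 100 200 (widen 1000 2000 ≤! ≤! r)))))
          ]′ (split 1000 (next 1 ≤! q))
        below-100 : Between (b 1) 40 100 → Visit
        below-100 q = [ below-50 , (λ r → from-5-10 1 ≤! (shift 5 10 r)) ]′ (split 50 q)

    digit-1-visited : Visit
    digit-1-visited = [ (λ p → 0 , z≤n , between⇒digit p) , (λ p → [ from-2-5 , from-5-10 0 z≤n ]′ (split 5 p)) ]′
      (split 2 (between-1-10 0<b))

-- From windows of positions to windows of indices.

module Enumeration (em : ExcludedMiddle 0ℓ) (R : CompleteOrderedField)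
  {ν : ℕ → ℕ} {S : ℕ → Set} (enum : Benford.Enumerates em R ν S) where

  open Benford.Enumerates enum
  open ℕ.≤-Reasoning

  member : ∀ i → 1 ℕ.≤ i → S (ν i)
  member i 1≤i = Equivalence.from (range (ν i)) (i , 1≤i , ≡.refl)

  index : ∀ {n} → S n → ∃[ i ] (1 ℕ.≤ i × ν i ≡ n)
  index {n} = Equivalence.to (range n)

  ν-mono-≤ : ∀ {i j} → 1 ℕ.≤ i → i ℕ.≤ j → ν i ℕ.≤ ν j
  ν-mono-≤ {i} 1≤i i≤j = go (ℕ.≤⇒≤′ i≤j)
    where
    go : ∀ {j} → i ℕ.≤′ j → ν i ℕ.≤ ν j
    go (ℕ.≤′-reflexive ≡.refl) = ℕ.≤-refl
    go (ℕ.≤′-step i≤′j) = ℕ.≤-trans (go i≤′j) (ℕ.<⇒≤ (increasing _ (ℕ.≤-trans 1≤i (ℕ.≤′⇒≤ i≤′j))))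

  ν-cancel-< : ∀ {i j} → 1 ℕ.≤ j → ν i ℕ.< ν j → i ℕ.< j
  ν-cancel-< 1≤j νi<νj = ℕ.≰⇒> λ j≤i → ℕ.<⇒≱ νi<νj (ν-mono-≤ 1≤j j≤i)

  -- Converts a window length measured against the index into one measured against the position. The
  -- extra 1 allows for an enumeration that starts with `ν 1` equal to 0.
  i≤1+ν : ∀ i → i ℕ.≤ suc (ν i)
  i≤1+ν zero          = z≤n
  i≤1+ν (suc zero)    = s≤s z≤n
  i≤1+ν (suc (suc i)) = s≤s (ℕ.≤-trans (i≤1+ν (suc i)) (increasing (suc i) (s≤s z≤n)))

  next≤ : ∀ i {t} → 1 ℕ.≤ i → S t → ν i ℕ.< t → ν (suc i) ℕ.≤ t
  next≤ i 1≤i St νi<t = let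
      j , 1≤j , νj≡t = index St
      i<j = ν-cancel-< 1≤j (ℕ.<-≤-trans νi<t (ℕ.≤-reflexive (≡.sym νj≡t)))
    in ℕ.≤-trans (ν-mono-≤ (s≤s z≤n) i<j) (ℕ.≤-reflexive νj≡t)

  module _ (g q n : ℕ)
    (dense  : ∀ l → q ℕ.* (l ℕ.+ g) ℕ.≤ n → ∃[ j ] (j ℕ.≤ g × S (n ℕ.+ l ℕ.+ j)))
    (sparse : ∀ l → q ℕ.* l ℕ.≤ n → S (n ℕ.+ l) → ¬ S (suc (n ℕ.+ l)))
    (i : ℕ) (1≤i : 1 ℕ.≤ i) (n≤νi : n ℕ.≤ ν i) (νi≤n+g : ν i ℕ.≤ n ℕ.+ g) where

    -- By `dense`, one of the g + 1 positions following an element is again in `S`, so each index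
    -- advances by at most g + 1; the first lies within g of n.
    offset : ∀ j → q ℕ.* (suc g ℕ.* j ℕ.+ g) ℕ.≤ n → ∃[ l ] (l ℕ.≤ suc g ℕ.* j ℕ.+ g × n ℕ.+ l ≡ ν (i ℕ.+ j))
    offset zero    p rewrite ℕ.*-zeroʳ g | ℕ.+-identityʳ i =
      ν i ℕ.∸ n , ℕ.m≤n+o⇒m∸n≤o (ν i) n νi≤n+g , ℕ.m+[n∸m]≡n n≤νi
    offset (suc j) p = ν (i ℕ.+ suc j) ℕ.∸ n ,
      ℕ.m≤n+o⇒m∸n≤o _ n (begin
        ν (i ℕ.+ suc j)                    ≡⟨ ≡.cong ν (ℕ.+-suc i j) ⟩
        ν (suc (i ℕ.+ j))                  ≤⟨ next≤ (i ℕ.+ j) (ℕ.≤-trans 1≤i (ℕ.m≤m+n i j)) St νi+j<t ⟩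
        n ℕ.+ suc l ℕ.+ k                  ≡⟨ ℕ.+-assoc n (suc l) k ⟩
        n ℕ.+ (suc l ℕ.+ k)                ≤⟨ ℕ.+-monoʳ-≤ n (ℕ.+-mono-≤ (s≤s l≤) k≤g) ⟩
        n ℕ.+ (suc (suc g ℕ.* j ℕ.+ g) ℕ.+ g) ≡⟨ ≡.cong (n ℕ.+_) (rearrange g j) ⟩
        n ℕ.+ (suc g ℕ.* suc j ℕ.+ g)      ∎) ,
      ℕ.m+[n∸m]≡n (ℕ.≤-trans n≤νi (ν-mono-≤ 1≤i (ℕ.m≤m+n i (suc j))))
      where
      rearrange : ∀ g j → suc (suc g ℕ.* j ℕ.+ g) ℕ.+ g ≡ suc g ℕ.* suc j ℕ.+ g
      rearrange = solve-∀
      previous = offset j (ℕ.≤-trans (ℕ.*-monoʳ-≤ q (ℕ.+-monoˡ-≤ g (ℕ.*-monoʳ-≤ (suc g) (ℕ.n≤1+n j)))) p)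
      l = proj₁ previous
      l≤ = proj₁ (proj₂ previous)
      visit = dense (suc l) (ℕ.≤-trans (ℕ.*-monoʳ-≤ q (ℕ.≤-trans (ℕ.+-monoˡ-≤ g (s≤s l≤)) (ℕ.≤-reflexive (rearrange g j)))) p)
      k = proj₁ visit
      k≤g = proj₁ (proj₂ visit)
      St = proj₂ (proj₂ visit)
      νi+j<t : ν (i ℕ.+ j) ℕ.< n ℕ.+ suc l ℕ.+ k
      νi+j<t = begin-strict
        ν (i ℕ.+ j)        ≡⟨ proj₂ (proj₂ previous) ⟨
        n ℕ.+ l            <⟨ ℕ.+-monoʳ-< n (ℕ.n<1+n l) ⟩
        n ℕ.+ suc l        ≤⟨ ℕ.m≤m+n _ k ⟩
        n ℕ.+ suc l ℕ.+ k  ∎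

    -- `offset` keeps the element inside the window, where a unit step would contradict `sparse`.
    no-unit-step : ∀ j → q ℕ.* (suc g ℕ.* j ℕ.+ g) ℕ.≤ n → ¬ (ν (suc (i ℕ.+ j)) ℕ.∸ ν (i ℕ.+ j) ≡ 1)
    no-unit-step j p step = let
        l , l≤ , n+l≡ν = offset j p
        1≤i+j = ℕ.≤-trans 1≤i (ℕ.m≤m+n i j)
        next≡ = ≡.trans (≡.sym (ℕ.m∸n+n≡m (ℕ.<⇒≤ (increasing (i ℕ.+ j) 1≤i+j)))) (≡.cong (ℕ._+ ν (i ℕ.+ j)) step)
      in sparse l (ℕ.≤-trans (ℕ.*-monoʳ-≤ q l≤) p)
           (≡.subst S (≡.sym n+l≡ν) (member (i ℕ.+ j) 1≤i+j))
           (≡.subst S (≡.trans next≡ (≡.cong suc (≡.sym n+l≡ν))) (member (suc (i ℕ.+ j)) (s≤s z≤n)))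

-- Failure of both Benford properties.

module NonBenford (em : ExcludedMiddle 0ℓ) (R : CompleteOrderedField)
  (a : ℕ → CompleteOrderedField.Carrier R)
  (a-pos : ∀ n → 1 ℕ.≤ n → CompleteOrderedField._<_ R (CompleteOrderedField.0# R) (a n))
  (Δ→∞ : Benford._⟶∞ em R (Benford.Δlog em R a))
  (ΔΔ=O : Benford._=O_ em R
    (λ n → CompleteOrderedField._-_ R (Benford.Δlog em R a (suc n)) (Benford.Δlog em R a n))
    (λ n → Benford._/_ em R (CompleteOrderedField.1# R) (Benford.fromℕ em R n))) where

  open Benford em R hiding (zero)
  open OrderedField em R
  open Exponential em R
  open Density em R
  open LeadingDigits em R

  private
    slow : ∃[ q ] (∀ M → ∃[ n ] (M ℕ.≤ n × (∀ j → suc q ℕ.* j ℕ.≤ n → Doubles (a (n ℕ.+ j)) (a (suc (n ℕ.+ j))))))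
    slow = let
        1< = λ m 1<m → <-resp-≈ fromℕ-1 refl (fromℕ-mono-< {1} {m} 1<m)
        q , windows = Growth.slow-windows em R a a-pos Δ→∞ ΔΔ=O {fromℕ 20} {fromℕ 10} {fromℕ 21}
          (1< 20 ≤!) (1< 10 ≤!) (fromℕ-mono-< {20} {21} ≤!)
      in q , λ M → let n , M≤n , k , ratio = windows M in n , M≤n , λ j qj≤n → k , ratio j qj≤n

    q : ℕ
    q = proj₁ slow

  ¬locallyBenford : ∀ k → 2 ℕ.≤ k → ¬ LocallyBenford a k
  ¬locallyBenford (suc (suc k)) _ benford =
    hasDensity⇒¬hasGaps q (product-pos (suc (suc k)) (P-pos one)) (benford (λ _ → one)) λ M → let
        n , M≤n , doubles = proj₂ slow M
      in n , M≤n , λ j qj≤n ones → ¬1-twice (doubles j qj≤n)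
           (≡.subst (λ m → D[ a m ]= one) (ℕ.+-identityʳ (n ℕ.+ j)) (ones Fin.zero))
           (≡.subst (λ m → D[ a m ]= one) (ℕ.+-comm (n ℕ.+ j) 1) (ones (Fin.suc Fin.zero)))
    where
    product-pos : ∀ n {x} → 0# < x → 0# < RawSemiringDefs.product (Semiring.rawSemiring semiring) {n} (λ _ → x)
    product-pos zero    0<x = 0<1
    product-pos (suc n) 0<x = *-pos 0<x (product-pos n 0<x)
  ¬locallyBenford (suc zero) (s≤s ())

  ¬benfordWaitingTimes : ¬ BenfordWaitingTimes a
  -- The gap parameter is the successor of this argument, which computes to 14 (q + 1). `waiting 0`
  -- concerns waiting time 1, with density P(1) (1 - P(1))⁰.
  ¬benfordWaitingTimes benford = hasDensity⇒¬hasGaps (q ℕ.+ 13 ℕ.* suc q)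
    (<-resp-≈ refl (sym (*-identityʳ (P one))) (P-pos one)) (waiting 0) gaps
    where
    ν = proj₁ (benford one)
    enum = proj₁ (proj₂ (benford one))
    waiting = proj₂ (proj₂ (benford one))
    open Enumeration em R enum

    Ones : ℕ → Set
    Ones n = 1 ℕ.≤ n × D[ a n ]= one

    -- 14 = 2 · 7: an index advances by at most 7 positions, and the factor 2 makes room for the
    -- additive constants in `near`, where twice the required bound is compared with n + n.
    gaps : HasGaps (λ i → ν (suc i) ℕ.∸ ν i ≡ 1) (14 ℕ.* suc q)
    gaps M = i , M≤i , λ j 14qj≤i → no-unit-step 6 (suc q) n dense sparse i 1≤i n≤νi νi≤n+6 j (near j 14qj≤i)
      where
      -- A start beyond `ν (suc M)` forces i ≥ M; the summand 7 + 12 (q + 1) is what remains to be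
      -- absorbed by the second n in `near`.
      window = proj₂ slow (suc (ν (suc M)) ℕ.+ (7 ℕ.+ 12 ℕ.* suc q))
      n = proj₁ window
      doubles = proj₂ (proj₂ window)
      νM<n : ν (suc M) ℕ.< n
      νM<n = ℕ.m+n≤o⇒m≤o (suc (ν (suc M))) (proj₁ (proj₂ window))
      7+12q≤n : 7 ℕ.+ 12 ℕ.* suc q ℕ.≤ n
      7+12q≤n = ℕ.m+n≤o⇒n≤o (suc (ν (suc M))) (proj₁ (proj₂ window))
      1≤n+ : ∀ k → 1 ℕ.≤ n ℕ.+ k
      1≤n+ k = ℕ.≤-trans (s≤s z≤n) (ℕ.≤-trans νM<n (ℕ.m≤m+n n k))
      sparse : ∀ l → suc q ℕ.* l ℕ.≤ n → Ones (n ℕ.+ l) → ¬ Ones (suc (n ℕ.+ l))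
      sparse l ql≤n (_ , d) (_ , d′) = ¬1-twice (doubles l ql≤n) d d′
      dense : ∀ l → suc q ℕ.* (l ℕ.+ 6) ℕ.≤ n → ∃[ j ] (j ℕ.≤ 6 × Ones (n ℕ.+ l ℕ.+ j))
      dense l p = let
          j , j≤6 , d = digit-1-visited (λ j → a (n ℕ.+ l ℕ.+ j)) (a-pos _ (1≤n+l+ 0)) consecutive
        in j , j≤6 , 1≤n+l+ j , d
        where
        1≤n+l+ : ∀ j → 1 ℕ.≤ n ℕ.+ l ℕ.+ j
        1≤n+l+ j = ℕ.≤-trans (1≤n+ l) (ℕ.m≤m+n (n ℕ.+ l) j)
        consecutive : ∀ j → j ℕ.< 6 → Doubles (a (n ℕ.+ l ℕ.+ j)) (a (n ℕ.+ l ℕ.+ suc j))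
        consecutive j j<6 = ≡.subst₂ (λ m m′ → Doubles (a m) (a m′)) (≡.sym (ℕ.+-assoc n l j))
          (≡.trans (≡.cong suc (≡.sym (ℕ.+-assoc n l j))) (≡.sym (ℕ.+-suc (n ℕ.+ l) j)))
          (doubles (l ℕ.+ j) (ℕ.≤-trans (ℕ.*-monoʳ-≤ (suc q) (ℕ.+-monoʳ-≤ l (ℕ.<⇒≤ j<6))) p))
      first = dense 0 (ℕ.≤-trans (ℕ.≤-reflexive (ℕ.*-comm (suc q) 6))
        (ℕ.≤-trans (ℕ.*-monoˡ-≤ (suc q) {6} {12} ≤!) (ℕ.m+n≤o⇒n≤o 7 7+12q≤n)))
      first-index = index (proj₂ (proj₂ first))
      i = proj₁ first-index
      1≤i = proj₁ (proj₂ first-index)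
      νi≡ : ν i ≡ n ℕ.+ proj₁ first
      νi≡ = ≡.trans (proj₂ (proj₂ first-index)) (≡.cong (ℕ._+ proj₁ first) (ℕ.+-identityʳ n))
      n≤νi : n ℕ.≤ ν i
      n≤νi = ℕ.≤-trans (ℕ.m≤m+n n _) (ℕ.≤-reflexive (≡.sym νi≡))
      νi≤n+6 : ν i ℕ.≤ n ℕ.+ 6
      νi≤n+6 = ℕ.≤-trans (ℕ.≤-reflexive νi≡) (ℕ.+-monoʳ-≤ n (proj₁ (proj₂ first)))
      M≤i : M ℕ.≤ i
      M≤i = ℕ.≤-trans (ℕ.n≤1+n M) (ℕ.<⇒≤ (ν-cancel-< 1≤i (ℕ.<-≤-trans νM<n n≤νi)))
      near : ∀ j → 14 ℕ.* suc q ℕ.* j ℕ.≤ i → suc q ℕ.* (7 ℕ.* j ℕ.+ 6) ℕ.≤ n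
      near j 14qj≤i = ℕ.*-cancelˡ-≤ 2 (begin
        2 ℕ.* (suc q ℕ.* (7 ℕ.* j ℕ.+ 6))         ≡⟨ expand (suc q) j ⟩
        14 ℕ.* suc q ℕ.* j ℕ.+ 12 ℕ.* suc q       ≤⟨ ℕ.+-monoˡ-≤ _ (ℕ.≤-trans 14qj≤i (ℕ.≤-trans (i≤1+ν i) (s≤s νi≤n+6))) ⟩
        suc (n ℕ.+ 6) ℕ.+ 12 ℕ.* suc q            ≡⟨ collect n (12 ℕ.* suc q) ⟩
        n ℕ.+ (7 ℕ.+ 12 ℕ.* suc q)                ≤⟨ ℕ.+-monoʳ-≤ n 7+12q≤n ⟩
        n ℕ.+ n                                   ≡⟨ ≡.cong (n ℕ.+_) (ℕ.+-identityʳ n) ⟨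
        2 ℕ.* n                                   ∎)
        where
        open ℕ.≤-Reasoning
        expand : ∀ q j → 2 ℕ.* (q ℕ.* (7 ℕ.* j ℕ.+ 6)) ≡ 14 ℕ.* q ℕ.* j ℕ.+ 12 ℕ.* q
        expand = solve-∀
        collect : ∀ n r → suc (n ℕ.+ 6) ℕ.+ r ≡ n ℕ.+ (7 ℕ.+ r)
        collect = solve-∀

theorem2p9 : (em : ExcludedMiddle 0ℓ) (R : CompleteOrderedField) →
    let open Benford em R in
    (a : ℕ → ℝ) →
    (∀ n → 1 ℕ.≤ n → 0# < a n) →
    Δlog a ⟶∞ →
    (λ n → Δlog a (suc n) - Δlog a n) =O (λ n → 1# / fromℕ n) →
    (∀ k → 2 ℕ.≤ k → ¬ LocallyBenford a k) × ¬ BenfordWaitingTimes a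
theorem2p9 em R a a-pos Δ→∞ ΔΔ=O =
  NonBenford.¬locallyBenford em R a a-pos Δ→∞ ΔΔ=O , NonBenford.¬benfordWaitingTimes em R a a-pos Δ→∞ ΔΔ=O
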